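{- Suppose $\mathcal{F}$ is a thin Kurepa family and $\mathcal{P}$ is a ccc poset. Then $\Vdash_{\mathcal{P}}$ "$\check{\mathcal{F}}$ is a thin Kurepa family".
   Context: A family $\mathscr{A}\subseteq[\omega_1]^{<\omega}$ (of nonempty finite sets) is non-overlapping if for all $a\neq b$ in $\mathscr{A}$, either $\max(a)<\min(b)$ or $\max(b)<\min(a)$. For $\mathcal{F}\subseteq P([\omega_1]^{<\omega})$ such that every $\mathscr{A}\in\mathcal{F}$ is pairwise disjoint, and $a\subseteq\omega_1$, $cl(a,\mathcal{F})$ is the $\subseteq$-least $a^*\subseteq\omega_1$ such that $a\subseteq a^*$ and for all $\mathscr{A}\in\mathcal{F}$ and all $b\in\mathscr{A}$, either $b\cap a^*=\emptyset$ or $b\subseteq a^*$. For $\alpha<\omega_1$, $\mathcal{F}\upharpoonright\alpha=\{\mathscr{A}\cap[\alpha]^{<\omega}:\mathscr{A}\in\mathcal{F}\}$. $\mathcal{F}\subseteq P([\omega_1]^{<\omega})$ is a thin Kurepa family if it consists of non-overlapping families and: (K1) for every $\alpha<\omega_1$, $|\mathcal{F}\upharpoonright\alpha|\le\omega$; (K2) for every uncountable pairwise disjoint family $\mathscr{A}\subseteq[\omega_1]^{<\omega}$ there is $\mathscr{B}\in\mathcal{F}$ with $|\mathscr{A}\cap\mathscr{B}|=\omega_1$; (K3) for every $a\in[\omega_1]^{<\omega}$ and every $\mathcal{F}'\in[\mathcal{F}]^{<\omega}$, $cl(a,\mathcal{F}')$ is finite. -}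

module Defs where

open import Level using (Level; Lift; suc)
open import Data.Nat.Base using (ℕ)
open import Data.Product.Base using (Σ; ∃; _×_; _,_; proj₁; proj₂)
open import Data.Sum.Base using (_⊎_)
open import Function.Base using (_on_)
open import Function.Definitions using (Injective)
open import Relation.Binary.Bundles using (Poset)
open import Relation.Binary.PropositionalEquality.Core using (_≡_)
open import Relation.Nullary.Negation.Core using (¬_)

private
  variable
    a ℓ : Level
    X : Set a

-- The language of set theory, with parameters from X.  Binders are
-- represented by functions (higher-order syntax).  The same formula is
-- interpreted below both in the ground model and in the forcing extension.

infix  7 _∈̇_ _≐_ _⊆̇_
infix  6 ¬̇_
infixr 5 _∧̇_
infixr 4 _∨̇_
infixr 3 _⇒̇_
infix  2 _⇔̇_

data Formula (X : Set a) : Set a where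
  _∈̇_ _≐_       : X → X → Formula X
  ¬̇_            : Formula X → Formula X
  _∧̇_ _∨̇_ _⇒̇_ : Formula X → Formula X → Formula X
  all ex         : (X → Formula X) → Formula X

all∈ ex∈ : X → (X → Formula X) → Formula X
all∈ x φ = all (λ y → y ∈̇ x ⇒̇ φ y)
ex∈  x φ = ex  (λ y → y ∈̇ x ∧̇ φ y)

infix 1 all ex all∈ ex∈
syntax all (λ x → φ) = ∀̇[ x ] φ
syntax ex  (λ x → φ) = ∃̇[ x ] φ
syntax all∈ x (λ y → φ) = ∀̇⟨ y ∈ x ⟩ φ
syntax ex∈  x (λ y → φ) = ∃̇⟨ y ∈ x ⟩ φ

_⇔̇_ : Formula X → Formula X → Formula X
φ ⇔̇ ψ = (φ ⇒̇ ψ) ∧̇ (ψ ⇒̇ φ)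

_⊆̇_ : X → X → Formula X
x ⊆̇ y = ∀̇⟨ z ∈ x ⟩ z ∈̇ y

nonempty : X → Formula X
nonempty x = ∃̇[ z ] z ∈̇ x

disjoint : X → X → Formula X
disjoint x y = ¬̇ (∃̇[ z ] z ∈̇ x ∧̇ z ∈̇ y)

-- z = x ∩ y
isIntersection : X → X → X → Formula X
isIntersection z x y = ∀̇[ u ] u ∈̇ z ⇔̇ u ∈̇ x ∧̇ u ∈̇ y

-- z = {x , y}
isPair : X → X → X → Formula X
isPair z x y = ∀̇[ u ] u ∈̇ z ⇔̇ u ≐ x ∨̇ u ≐ y

-- z = {{x} , {x , y}}
isOrderedPair : X → X → X → Formula X
isOrderedPair z x y = ∃̇[ s ] ∃̇[ t ] isPair s x x ∧̇ isPair t x y ∧̇ isPair z s t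

-- ⟨x , y⟩ ∈ f
maps : X → X → X → Formula X
maps f x y = ∃̇⟨ z ∈ f ⟩ isOrderedPair z x y

-- f : x → y
isFunction : X → X → X → Formula X
isFunction f x y =
    (∀̇⟨ z ∈ f ⟩ ∃̇⟨ u ∈ x ⟩ ∃̇⟨ v ∈ y ⟩ isOrderedPair z u v)
  ∧̇ (∀̇⟨ u ∈ x ⟩ ∃̇⟨ v ∈ y ⟩ maps f u v ∧̇ (∀̇[ v′ ] maps f u v′ ⇒̇ v′ ≐ v))

isInjection : X → X → X → Formula X
isInjection f x y =
    isFunction f x y
  ∧̇ (∀̇⟨ u ∈ x ⟩ ∀̇⟨ u′ ∈ x ⟩ ∀̇[ v ] maps f u v ∧̇ maps f u′ v ⇒̇ u ≐ u′)

isBijection : X → X → X → Formula X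
isBijection f x y = isInjection f x y ∧̇ (∀̇⟨ v ∈ y ⟩ ∃̇⟨ u ∈ x ⟩ maps f u v)

-- |x| ≤ |y| and |x| = |y|
_≼̇_ _≃̇_ : X → X → Formula X
x ≼̇ y = ∃̇[ f ] isInjection f x y
x ≃̇ y = ∃̇[ f ] isBijection f x y

transitive : X → Formula X
transitive x = ∀̇⟨ y ∈ x ⟩ y ⊆̇ x

-- Correct in the presence of Foundation.
ordinal : X → Formula X
ordinal x = transitive x ∧̇ (∀̇⟨ y ∈ x ⟩ transitive y)

limit : X → Formula X
limit x = ordinal x ∧̇ nonempty x ∧̇ (∀̇⟨ y ∈ x ⟩ ∃̇⟨ z ∈ x ⟩ y ∈̇ z)

isω : X → Formula X
isω x = limit x ∧̇ (∀̇⟨ n ∈ x ⟩ ¬̇ limit n)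

finite countable : X → Formula X
finite    x = ∃̇[ w ] isω w ∧̇ (∃̇⟨ n ∈ w ⟩ x ≃̇ n)
countable x = ∃̇[ w ] isω w ∧̇ x ≼̇ w

isω₁ : X → Formula X
isω₁ x = ordinal x ∧̇ ¬̇ countable x ∧̇ (∀̇⟨ α ∈ x ⟩ countable α)

-- x ∈ [y]^{<ω}; the empty set is included here, and excluded explicitly
-- from the members of a Kurepa family in `familiesOn`.
finiteSubset : X → X → Formula X
finiteSubset x y = x ⊆̇ y ∧̇ finite x

-- For sets of ordinals, whose order is membership.
isMax isMin : X → X → Formula X
isMax m x = m ∈̇ x ∧̇ (∀̇⟨ y ∈ x ⟩ y ∈̇ m ∨̇ y ≐ m)
isMin m x = m ∈̇ x ∧̇ (∀̇⟨ y ∈ x ⟩ m ∈̇ y ∨̇ m ≐ y)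

-- max(x) < min(y)
_max<min_ : X → X → Formula X
x max<min y = ∃̇[ m ] ∃̇[ n ] isMax m x ∧̇ isMin n y ∧̇ m ∈̇ n

nonOverlapping pairwiseDisjoint : X → Formula X
nonOverlapping A =
  ∀̇⟨ x ∈ A ⟩ ∀̇⟨ y ∈ A ⟩ ¬̇ (x ≐ y) ⇒̇ (x max<min y) ∨̇ (y max<min x)
pairwiseDisjoint A =
  ∀̇⟨ x ∈ A ⟩ ∀̇⟨ y ∈ A ⟩ ¬̇ (x ≐ y) ⇒̇ disjoint x y

-- In the following, w plays the role of ω₁.

isClosedOver : X → X → X → X → Formula X
isClosedOver w c x F =
  c ⊆̇ w ∧̇ x ⊆̇ c ∧̇ (∀̇⟨ A ∈ F ⟩ ∀̇⟨ b ∈ A ⟩ disjoint b c ∨̇ b ⊆̇ c)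

-- c = cl(x , F)
isClosure : X → X → X → X → Formula X
isClosure w c x F =
  isClosedOver w c x F ∧̇ (∀̇[ d ] isClosedOver w d x F ⇒̇ c ⊆̇ d)

-- B = A ∩ [α]^{<ω}
isTrace : X → X → X → Formula X
isTrace B A α = ∀̇[ x ] x ∈̇ B ⇔̇ x ∈̇ A ∧̇ finiteSubset x α

-- R = F ↾ α
isRestriction : X → X → X → Formula X
isRestriction R F α = ∀̇[ B ] B ∈̇ R ⇔̇ (∃̇⟨ A ∈ F ⟩ isTrace B A α)

familiesOn K1 K2 K3 : X → X → Formula X
familiesOn w F =
  ∀̇⟨ A ∈ F ⟩ (∀̇⟨ x ∈ A ⟩ finiteSubset x w ∧̇ nonempty x) ∧̇ nonOverlapping A
K1 w F =
  ∀̇⟨ α ∈ w ⟩ ∃̇[ R ] isRestriction R F α ∧̇ countable R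
K2 w F =
  ∀̇[ A ] (∀̇⟨ x ∈ A ⟩ finiteSubset x w) ∧̇ ¬̇ countable A ∧̇ pairwiseDisjoint A
    ⇒̇ (∃̇⟨ B ∈ F ⟩ ∃̇[ C ] isIntersection C A B ∧̇ C ≃̇ w)
K3 w F =
  ∀̇[ x ] finiteSubset x w ⇒̇
    (∀̇[ F′ ] finiteSubset F′ F ⇒̇ (∃̇[ c ] isClosure w c x F′ ∧̇ finite c))

thinKurepa : X → Formula X
thinKurepa F =
  ∃̇[ w ] isω₁ w ∧̇ familiesOn w F ∧̇ K1 w F ∧̇ K2 w F ∧̇ K3 w F

-- The ground model: Aczel's iterative sets, with extensional equality.

data V (ℓ : Level) : Set (suc ℓ) where
  sup : (I : Set ℓ) → (I → V ℓ) → V ℓ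

infix 4 _≈ᵛ_ _∈ᵛ_

_≈ᵛ_ : V ℓ → V ℓ → Set ℓ
sup I x ≈ᵛ sup J y =
  (∀ i → ∃ λ j → x i ≈ᵛ y j) × (∀ j → ∃ λ i → x i ≈ᵛ y j)

_∈ᵛ_ : V ℓ → V ℓ → Set ℓ
x ∈ᵛ sup J y = ∃ λ j → x ≈ᵛ y j

infix 1 V⊨_

V⊨_ : Formula (V ℓ) → Set (suc ℓ)
V⊨ (x ∈̇ y)  = Lift _ (x ∈ᵛ y)
V⊨ (x ≐ y)   = Lift _ (x ≈ᵛ y)
V⊨ (¬̇ φ)    = ¬ (V⊨ φ)
V⊨ (φ ∧̇ ψ)  = (V⊨ φ) × (V⊨ ψ)
V⊨ (φ ∨̇ ψ)  = (V⊨ φ) ⊎ (V⊨ ψ)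
V⊨ (φ ⇒̇ ψ)  = V⊨ φ → V⊨ ψ
V⊨ (all φ)   = ∀ x → V⊨ φ x
V⊨ (ex φ)    = ∃ λ x → V⊨ φ x

module Forcing (P : Poset ℓ ℓ ℓ) where

  open Poset P renaming (Carrier to Cond)

  Compatible : Cond → Cond → Set ℓ
  Compatible p q = ∃ λ r → r ≤ p × r ≤ q

  Antichain : (Cond → Set ℓ) → Set ℓ
  Antichain A = ∀ p q → A p → A q → ¬ (p ≈ q) → ¬ Compatible p q

  CCC : Set (suc ℓ)
  CCC = (A : Cond → Set ℓ) → Antichain A →
        ∃ λ (f : Σ Cond A → ℕ) → Injective (_≈_ on proj₁) _≡_ f

  DenseBelow : ∀ {d} → Cond → (Cond → Set d) → Set _
  DenseBelow p D = ∀ q → q ≤ p → ∃ λ r → r ≤ q × D r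

  -- name I σ s is the P-name {⟨σ i , s i⟩ : i ∈ I}.
  data Name : Set (suc ℓ) where
    name : (I : Set ℓ) → (I → Name) → (I → Cond) → Name

  -- The poset need not have a largest element, so every condition is
  -- attached to every member.
  check : V ℓ → Name
  check (sup I x) = name (I × Cond) (λ (i , _) → check (x i)) proj₂

  infix 3 _⊩_≈ⁿ_ _⊩_∈ⁿ_ _⊩_

  mutual
    _⊩_≈ⁿ_ : Cond → Name → Name → Set ℓ
    p ⊩ name I σ s ≈ⁿ name J τ t =
        (∀ i q → q ≤ p → q ≤ s i → q ⊩ σ i ∈ⁿ name J τ t)
      × (∀ j q → q ≤ p → q ≤ t j → q ⊩ τ j ∈ⁿ name I σ s)

    _⊩_∈ⁿ_ : Cond → Name → Name → Set ℓ
    p ⊩ π ∈ⁿ name J τ t =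
      DenseBelow p (λ q → ∃ λ j → q ≤ t j × (q ⊩ π ≈ⁿ τ j))

  _⊩_ : Cond → Formula Name → Set (suc ℓ)
  p ⊩ (x ∈̇ y)  = Lift _ (p ⊩ x ∈ⁿ y)
  p ⊩ (x ≐ y)   = Lift _ (p ⊩ x ≈ⁿ y)
  p ⊩ (¬̇ φ)    = ∀ q → q ≤ p → ¬ (q ⊩ φ)
  p ⊩ (φ ∧̇ ψ)  = (p ⊩ φ) × (p ⊩ ψ)
  p ⊩ (φ ∨̇ ψ)  = DenseBelow p (λ q → (q ⊩ φ) ⊎ (q ⊩ ψ))
  p ⊩ (φ ⇒̇ ψ)  = ∀ q → q ≤ p → q ⊩ φ → q ⊩ ψ
  p ⊩ (all φ)   = ∀ x → p ⊩ φ x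
  p ⊩ (ex φ)    = DenseBelow p (λ q → ∃ λ x → q ⊩ φ x)

  infix 1 ⊩_

  ⊩_ : Formula Name → Set (suc ℓ)
  ⊩ φ = ∀ p → p ⊩ φ

{-# OPTIONS --safe #-}
-- Write w for ω₁. The ccc keeps w uncountable: an injection of w into ω in the
-- extension would be decided at each point by some condition, and conditions deciding
-- the same value for different points are incompatible. Finite subsets of ground sets
-- lie in V, which gives (K1), and (K3) follows since whether an element of the ground
-- closure c belongs to a given closed set is decided by finitely many extensions.
--
-- For (K2) let p force A to be an uncountable disjoint family of finite sets.
-- Uncountability gives, above every γ in w, a nonempty finite set which some r ≤ p
-- forces into A; recursion along w yields ω₁ such sets, each beyond the previous ones,
-- and (K2) in V captures uncountably many of them in one B of F. Some q ≤ p
-- forces the maxima of the members of A ∩ B to be unbounded in w, since otherwise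
-- conditions bounding them could be thinned out to an uncountable antichain. Below q the
-- Mostowski collapse of these maxima is a bijection from A ∩ B onto w: if it omitted
-- α, its values would be ordinals below α, so by the ccc the maxima would be covered
-- by a countable, hence bounded, set of V.

module Submission where

open import Axiom.ExcludedMiddle using (ExcludedMiddle)
open import Axiom.Extensionality.Propositional using (Extensionality; lower-extensionality; implicit-extensionality)
open import Axiom.UniquenessOfIdentityProofs.WithK using (uip)
open import Data.Bool.Base using (Bool; true; false; if_then_else_; T)
open import Data.Bool.Properties using (T-irrelevant)
open import Data.Empty using (⊥; ⊥-elim)
open import Data.Empty.Polymorphic using () renaming (⊥ to ⊥ₗ)
open import Data.Fin.Base using (Fin; zero; suc; toℕ; fromℕ<)
import Data.Fin.Properties as Fin
open import Data.Maybe.Base using (Maybe; just; nothing; maybe)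
open import Data.Maybe.Properties using (just-injective)
open import Data.Nat.Base using (ℕ; zero; suc; _<_; _≤_; _+_; _≡ᵇ_; z≤n; s≤s)
import Data.Nat.Properties as ℕ
open import Data.Product.Base using (Σ; ∃; _×_; _,_; proj₁; proj₂)
open import Data.Sum.Base using (_⊎_; inj₁; inj₂; [_,_]′)
open import Data.Unit.Base using (⊤; tt)
open import Induction.WellFounded using (Acc; acc; WellFounded; module FixPoint; module All)
open import Level using (Level; Lift; lift; lower) renaming (suc to lsuc)
open import Relation.Binary.Bundles using (Poset)
import Relation.Binary.Construct.On as On
open import Relation.Binary.Definitions using (tri<; tri≈; tri>)
open import Relation.Binary.PropositionalEquality using (_≡_; refl; sym; trans; cong; subst; subst₂)
open import Relation.Nullary.Decidable.Core using (yes; no; does)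
open import Relation.Nullary.Negation.Core using (¬_)
open import Defs

-- The obstacle in (K2) is that `A` need not contain an uncountable set of V: its members are forced
-- by different, possibly incompatible conditions, so a family assembled in V consists only of sets
-- that may enter `A`. (K2) in V turns that family into `B`, and the ccc must then supply one
-- condition below which uncountably many of them do enter. Moreover the formula asks for a
-- bijection onto ω₁; since `B` is non-overlapping, its members are coded by their maxima, and the
-- collapse of a set of ordinals is a bijection that can be written down as a name.
--
-- Two features of the setting shape the rest. The index type of a name lies in `Set ℓ`, whereas
-- `_⊩_` lands one universe higher; so whatever goes into a name is phrased with `_⊩_∈ⁿ_` and
-- `_⊩_≈ⁿ_`, which stay in `Set ℓ`. And binders of formulas are functions, so relating the readings
-- of one formula at different parameters takes an induction over its instance at numbers.

private
  variable
    a ℓ : Level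
    X : Set a

-- Cantor's pairing function

triangle : ℕ → ℕ
triangle zero    = zero
triangle (suc n) = suc (n + triangle n)

triangle-mono : ∀ {m n} → m ≤ n → triangle m ≤ triangle n
triangle-mono z≤n = z≤n
triangle-mono (s≤s m≤n) = s≤s (ℕ.+-mono-≤ m≤n (triangle-mono m≤n))

pair : ℕ → ℕ → ℕ
pair m n = m + triangle (m + n)

-- Numbers on the diagonal `m + n` stay below `triangle (suc (m + n))`, where the next diagonal
-- starts.
pair-< : ∀ {m n m′ n′} → m + n < m′ + n′ → pair m n < pair m′ n′
pair-< {m} {n} {m′} {n′} lt =
  ℕ.<-≤-trans (s≤s (ℕ.+-monoˡ-≤ (triangle (m + n)) (ℕ.m≤m+n m n)))
    (ℕ.≤-trans (triangle-mono lt) (ℕ.m≤n+m (triangle (m′ + n′)) m′))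

pair-injective : ∀ {m n m′ n′} → pair m n ≡ pair m′ n′ → m ≡ m′ × n ≡ n′
pair-injective {m} {n} {m′} {n′} eq with ℕ.<-cmp (m + n) (m′ + n′)
... | tri< lt _ _ = ⊥-elim (ℕ.<⇒≢ (pair-< {m} {n} {m′} {n′} lt) eq)
... | tri> _ _ gt = ⊥-elim (ℕ.<⇒≢ (pair-< {m′} {n′} {m} {n} gt) (sym eq))
... | tri≈ _ s _ with ℕ.+-cancelʳ-≡ (triangle (m + n)) m m′ (trans eq (cong (λ k → m′ + triangle k) (sym s)))
...   | refl = refl , ℕ.+-cancelˡ-≡ m n n′ s

-- Elementary set theory in V: extensionality, foundation, ω

Ix : V ℓ → Set ℓ
Ix (sup I _) = I

el : (x : V ℓ) → Ix x → V ℓ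
el (sup _ x) = x

-- Record wrappers let Agda infer the sets from the type of a proof.
infix 4 _≋_ _∊_

record _≋_ (x y : V ℓ) : Set ℓ where
  constructor mk≋
  field un≋ : x ≈ᵛ y
open _≋_ public

record _∊_ (x y : V ℓ) : Set ℓ where
  constructor mk∊
  field un∊ : x ∈ᵛ y
open _∊_ public

module _ {ℓ : Level} where

  ≋-refl : {x : V ℓ} → x ≋ x
  ≋-refl {sup I x} = mk≋ ((λ i → i , un≋ (≋-refl {x i})) , (λ i → i , un≋ (≋-refl {x i})))

  ≋-sym : {x y : V ℓ} → x ≋ y → y ≋ x
  ≋-sym {sup I x} {sup J y} (mk≋ (f , g)) =
    mk≋ ((λ j → proj₁ (g j) , un≋ (≋-sym {x (proj₁ (g j))} {y j} (mk≋ (proj₂ (g j)))))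
        , (λ i → proj₁ (f i) , un≋ (≋-sym {x i} {y (proj₁ (f i))} (mk≋ (proj₂ (f i))))))

  ≋-trans : {x y z : V ℓ} → x ≋ y → y ≋ z → x ≋ z
  ≋-trans {sup I x} {sup J y} {sup K z} (mk≋ (f , g)) (mk≋ (h , k)) =
    mk≋ ((λ i → let j , p = f i ; l , q = h j in
               l , un≋ (≋-trans {x i} {y j} {z l} (mk≋ p) (mk≋ q)))
        , (λ l → let j , q = k l ; i , p = g j in
               i , un≋ (≋-trans {x i} {y j} {z l} (mk≋ p) (mk≋ q))))

  ≡⇒≋ : {x y : V ℓ} → x ≡ y → x ≋ y
  ≡⇒≋ refl = ≋-refl

  ∊-el : {x : V ℓ} (i : Ix x) → el x i ∊ x
  ∊-el {sup I x} i = mk∊ (i , un≋ (≋-refl {x i}))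

  ∊-index : {x y : V ℓ} → y ∊ x → ∃ λ i → y ≋ el x i
  ∊-index {sup I x} (mk∊ (i , p)) = i , mk≋ p

  ∊-respˡ : {x y z : V ℓ} → x ≋ y → x ∊ z → y ∊ z
  ∊-respˡ {z = sup K z} p (mk∊ (k , q)) = mk∊ (k , un≋ (≋-trans (≋-sym p) (mk≋ q)))

  ∊-intro : {x y : V ℓ} (i : Ix x) → y ≋ el x i → y ∊ x
  ∊-intro i p = ∊-respˡ (≋-sym p) (∊-el i)

  ∊-respʳ : {x y z : V ℓ} → y ≋ z → x ∊ y → x ∊ z
  ∊-respʳ {y = sup J y} {sup K z} (mk≋ (f , _)) (mk∊ (j , p)) =
    let k , q = f j in mk∊ (k , un≋ (≋-trans (mk≋ p) (mk≋ q)))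

  ≋-ext : {x y : V ℓ} → (∀ i → el x i ∊ y) → (∀ j → el y j ∊ x) → x ≋ y
  ≋-ext {sup I x} {sup J y} f g =
    mk≋ ((λ i → un∊ (f i)) , (λ j → let i , p = ∊-index (g j) in i , un≋ (≋-sym p)))

  ∊-acc : {x y : V ℓ} → y ≋ x → Acc _∊_ y
  ∊-acc {sup I x} p = acc λ q → let i , r = ∊-index (∊-respʳ p q) in ∊-acc {x i} r

  ∊-wf : WellFounded (_∊_ {ℓ})
  ∊-wf x = ∊-acc ≋-refl

  ∊-irrefl : {x y : V ℓ} → x ≋ y → ¬ (x ∊ y)
  ∊-irrefl {x} p q = go (∊-wf x) (∊-respʳ (≋-sym p) q)
    where
    go : ∀ {x} → Acc _∊_ x → ¬ (x ∊ x)
    go (acc rs) q = go (rs q) q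

  -- Von Neumann numerals, with `nothing` indexing the newly added top element `nat n`.
  nat : ℕ → V ℓ
  nat zero    = sup ⊥ₗ (λ ())
  nat (suc n) = sup (Maybe (Ix (nat n))) (maybe (el (nat n)) (nat n))

  nat-mem : ∀ {m n} → m < n → nat m ∊ nat n
  nat-mem {m} {suc n} (s≤s m≤n) with ℕ.m≤n⇒m<n∨m≡n m≤n
  ... | inj₂ refl = ∊-intro nothing ≋-refl
  ... | inj₁ lt = let i , p = ∊-index (nat-mem lt) in ∊-intro (just i) p

  nat-mem⁻ : ∀ n {x} → x ∊ nat n → ∃ λ m → m < n × x ≋ nat m
  nat-mem⁻ zero q with () ← proj₁ (∊-index q)
  nat-mem⁻ (suc n) q with ∊-index q
  ... | nothing , p = n , ℕ.≤-refl , p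
  ... | just i , p = let m , lt , r = nat-mem⁻ n (∊-intro i p) in m , ℕ.m<n⇒m<1+n lt , r

  nat-injective : ∀ {m n} → nat m ≋ nat n → m ≡ n
  nat-injective {m} {n} p with ℕ.<-cmp m n
  ... | tri< lt _ _ = ⊥-elim (∊-irrefl p (nat-mem lt))
  ... | tri≈ _ e _ = e
  ... | tri> _ _ gt = ⊥-elim (∊-irrefl (≋-sym p) (nat-mem gt))

  nat-mem-< : ∀ {m n} → nat m ∊ nat n → m < n
  nat-mem-< {m} {n} q with nat-mem⁻ n q
  ... | k , lt , p = subst (_< n) (sym (nat-injective p)) lt

  ω : V ℓ
  ω = sup (Lift ℓ ℕ) (λ n → nat (lower n))

  nat∊ω : ∀ n → nat n ∊ ω
  nat∊ω n = ∊-intro (lift n) ≋-refl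

  ω-index : ∀ {x} → x ∊ ω → ∃ λ n → x ≋ nat n
  ω-index q = let n , p = ∊-index q in lower n , p

  ∊↑ : {x y : V ℓ} → x ∊ y → V⊨ (x ∈̇ y)
  ∊↑ q = lift (un∊ q)

  ∊↓ : {x y : V ℓ} → V⊨ (x ∈̇ y) → x ∊ y
  ∊↓ q = mk∊ (lower q)

  nat-transitive : ∀ n → V⊨ transitive (nat n)
  nat-transitive n y y∈ z z∈ with nat-mem⁻ n (∊↓ y∈)
  ... | m , lt , p with nat-mem⁻ m (∊-respʳ p (∊↓ z∈))
  ...   | k , lt′ , r = ∊↑ (∊-respˡ (≋-sym r) (nat-mem (ℕ.<-trans lt′ lt)))

  transitive-resp : {x y : V ℓ} → x ≋ y → V⊨ transitive x → V⊨ transitive y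
  transitive-resp p t y y∈ z z∈ =
    ∊↑ (∊-respʳ p (∊↓ (t y (∊↑ (∊-respʳ (≋-sym p) (∊↓ y∈))) z z∈)))

  ω-limit : V⊨ limit ω
  ω-limit =
      ((λ y y∈ z z∈ → let n , p = ω-index (∊↓ y∈)
                          m , _ , q = nat-mem⁻ n (∊-respʳ p (∊↓ z∈))
                      in ∊↑ (∊-respˡ (≋-sym q) (nat∊ω m)))
      , (λ y y∈ → let n , p = ω-index (∊↓ y∈) in transitive-resp (≋-sym p) (nat-transitive n)))
    , (nat 0 , ∊↑ (nat∊ω 0))
    , (λ y y∈ → let n , p = ω-index (∊↓ y∈) in
         nat (suc n) , ∊↑ (nat∊ω (suc n)) , ∊↑ (∊-respˡ (≋-sym p) (nat-mem ℕ.≤-refl)))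

  nat-¬limit : ∀ n {x} → x ≋ nat n → ¬ (V⊨ limit x)
  nat-¬limit zero p (_ , (z , z∈) , _) with _ , () , _ ← nat-mem⁻ 0 (∊-respʳ p (∊↓ z∈))
  nat-¬limit (suc n) p (_ , _ , h)
    with z , z∈ , n∈z ← h (nat n) (∊↑ (∊-respʳ (≋-sym p) (nat-mem ℕ.≤-refl)))
    with nat-mem⁻ (suc n) (∊-respʳ p (∊↓ z∈))
  ... | m , lt , q = ℕ.<⇒≱ (nat-mem-< (∊-respʳ q (∊↓ n∈z))) (ℕ.≤-pred lt)

  ω-isω : V⊨ isω ω
  ω-isω = ω-limit , λ y y∈ → let n , p = ω-index (∊↓ y∈) in nat-¬limit n p

-- Formulas as syntax, and environments

update : (ℕ → X) → ℕ → X → ℕ → X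
update ρ k x j = if j ≡ᵇ k then x else ρ j

-- A formula over ℕ is read as a formula with de Bruijn levels as variables,
-- k being the first level not yet in use.
eval : ℕ → Formula ℕ → (ℕ → X) → Formula X
eval k (i ∈̇ j) ρ = ρ i ∈̇ ρ j
eval k (i ≐ j)  ρ = ρ i ≐ ρ j
eval k (¬̇ φ)   ρ = ¬̇ eval k φ ρ
eval k (φ ∧̇ ψ) ρ = eval k φ ρ ∧̇ eval k ψ ρ
eval k (φ ∨̇ ψ) ρ = eval k φ ρ ∨̇ eval k ψ ρ
eval k (φ ⇒̇ ψ) ρ = eval k φ ρ ⇒̇ eval k ψ ρ
eval k (all φ)  ρ = all λ x → eval (suc k) (φ k) (update ρ k x)
eval k (ex φ)   ρ = ex λ x → eval (suc k) (φ k) (update ρ k x)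

env₁ : X → ℕ → X
env₁ x _ = x

env₂ : X → X → ℕ → X
env₂ x y zero    = x
env₂ x y (suc _) = y

env₃ : X → X → X → ℕ → X
env₃ x y z zero    = x
env₃ x y z (suc j) = env₂ y z j

env₄ : X → X → X → X → ℕ → X
env₄ x y z u zero    = x
env₄ x y z u (suc j) = env₃ y z u j

update-same : (ρ : ℕ → X) (k : ℕ) (x : X) → update ρ k x k ≡ x
update-same ρ zero    x = refl
update-same ρ (suc k) x = update-same (λ j → ρ (suc j)) k x

update-other : (ρ : ℕ → X) (k : ℕ) (x : X) {j : ℕ} → (j ≡ᵇ k) ≡ false → update ρ k x j ≡ ρ j
update-other ρ k x {j} eq = cong (λ b → if b then x else ρ j) eq

update-rel : ∀ {b r} {Y : Set b} (R : X → Y → Set r) {ρ : ℕ → X} {σ : ℕ → Y} (k : ℕ) {x : X} {y : Y} →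
             (∀ j → R (ρ j) (σ j)) → R x y → ∀ j → R (update ρ k x j) (update σ k y j)
update-rel R k h r j with j ≡ᵇ k
... | true  = r
... | false = h j

-- Absoluteness and the calculus of forcing

data Polarity : Set where
  up dn : Polarity

opposite : Polarity → Polarity
opposite up = dn
opposite dn = up

-- Pol up k φ makes φ upward absolute (from V to the extension), Pol dn k φ
-- downward absolute; the quantifiers in ∀∈ and ∃∈ are bounded.
data Pol : Polarity → ℕ → Formula ℕ → Set where
  mem : ∀ {s k i j} → Pol s k (i ∈̇ j)
  equ : ∀ {s k i j} → Pol s k (i ≐ j)
  neg : ∀ {s k φ} → Pol (opposite s) k φ → Pol s k (¬̇ φ)
  and : ∀ {s k φ ψ} → Pol s k φ → Pol s k ψ → Pol s k (φ ∧̇ ψ)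
  or  : ∀ {s k φ ψ} → Pol s k φ → Pol s k ψ → Pol s k (φ ∨̇ ψ)
  imp : ∀ {s k φ ψ} → Pol (opposite s) k φ → Pol s k ψ → Pol s k (φ ⇒̇ ψ)
  ∀↓  : ∀ {k φ} → Pol dn (suc k) (φ k) → Pol dn k (all φ)
  ∃↑  : ∀ {k φ} → Pol up (suc k) (φ k) → Pol up k (ex φ)
  ∀∈  : ∀ {k φ b ψ} → φ k ≡ (k ∈̇ b ⇒̇ ψ) → (b ≡ᵇ k) ≡ false → Pol up (suc k) ψ → Pol up k (all φ)
  ∃mem : ∀ {k φ b} → φ k ≡ (k ∈̇ b) → (b ≡ᵇ k) ≡ false → Pol dn k (ex φ)
  ∃∈  : ∀ {k φ b ψ} → φ k ≡ (k ∈̇ b ∧̇ ψ) → (b ≡ᵇ k) ≡ false → Pol dn (suc k) ψ → Pol dn k (ex φ)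

ordinal↑ : Pol up 1 (ordinal 0)
ordinal↑ = and (∀∈ refl refl (∀∈ refl refl mem)) (∀∈ refl refl (∀∈ refl refl (∀∈ refl refl mem)))

transitive↓ : ∀ {k x} → Pol dn k (transitive x)
transitive↓ = ∀↓ (imp mem (∀↓ (imp mem mem)))

module Names {ℓ} (P : Poset ℓ ℓ ℓ) where

  open Forcing P public
  open Poset P public
    using () renaming (Carrier to Cond; _≤_ to _⊑_; _≈_ to _≈ᶜ_; refl to ⊑-refl; trans to ⊑-trans; reflexive to ⊑-reflexive)

  private
    variable
      c d : Level
      p q r : Cond
      Φ : Cond → Set c
      Ψ : Cond → Set d

  dense-all : (∀ {q} → q ⊑ p → Φ q) → DenseBelow p Φ
  dense-all h q q≤p = q , ⊑-refl , h q≤p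

  dense-mono : DenseBelow p Φ → q ⊑ p → DenseBelow q Φ
  dense-mono h q≤p r r≤q = h r (⊑-trans r≤q q≤p)

  dense-bind : DenseBelow p Φ → (∀ {q} → q ⊑ p → Φ q → DenseBelow q Ψ) → DenseBelow p Ψ
  dense-bind h k q q≤p =
    let r , r≤q , φ = h q q≤p
        s , s≤r , ψ = k (⊑-trans r≤q q≤p) φ r ⊑-refl
    in s , ⊑-trans s≤r r≤q , ψ

  dense-map : DenseBelow p Φ → (∀ {q} → q ⊑ p → Φ q → Ψ q) → DenseBelow p Ψ
  dense-map h k q q≤p = let r , r≤q , φ = h q q≤p in r , r≤q , k (⊑-trans r≤q q≤p) φ

  dense-here : DenseBelow p Φ → ∃ λ q → q ⊑ p × Φ q
  dense-here h = h _ ⊑-refl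

  ∈ⁿ-mono : ∀ σ τ → p ⊩ σ ∈ⁿ τ → q ⊑ p → q ⊩ σ ∈ⁿ τ
  ∈ⁿ-mono σ (name J τ t) h q≤p = λ r r≤q → h r (⊑-trans r≤q q≤p)

  ≈ⁿ-mono : ∀ σ τ → p ⊩ σ ≈ⁿ τ → q ⊑ p → q ⊩ σ ≈ⁿ τ
  ≈ⁿ-mono (name I σ s) (name J τ t) (f , g) q≤p =
    (λ i r r≤q → f i r (⊑-trans r≤q q≤p)) , (λ j r r≤q → g j r (⊑-trans r≤q q≤p))

  ∈ⁿ-local : ∀ σ τ → DenseBelow p (λ q → q ⊩ σ ∈ⁿ τ) → p ⊩ σ ∈ⁿ τ
  ∈ⁿ-local σ (name J τ t) h = dense-bind h λ _ k → k

  ≈ⁿ-local : ∀ σ τ → DenseBelow p (λ q → q ⊩ σ ≈ⁿ τ) → p ⊩ σ ≈ⁿ τ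
  ≈ⁿ-local (name I σ s) (name J τ t) h =
      (λ i q q≤p q≤s → ∈ⁿ-local (σ i) (name J τ t)
         (λ r r≤q → let u , u≤r , f , _ = h r (⊑-trans r≤q q≤p) in
            u , u≤r , f i u ⊑-refl (⊑-trans u≤r (⊑-trans r≤q q≤s))))
    , (λ j q q≤p q≤t → ∈ⁿ-local (τ j) (name I σ s)
         (λ r r≤q → let u , u≤r , _ , g = h r (⊑-trans r≤q q≤p) in
            u , u≤r , g j u ⊑-refl (⊑-trans u≤r (⊑-trans r≤q q≤t))))

  ≈ⁿ-refl : ∀ σ → p ⊩ σ ≈ⁿ σ
  ≈ⁿ-refl (name I σ s) =
      (λ i q _ q≤s r r≤q → r , ⊑-refl , i , ⊑-trans r≤q q≤s , ≈ⁿ-refl (σ i))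
    , (λ i q _ q≤s r r≤q → r , ⊑-refl , i , ⊑-trans r≤q q≤s , ≈ⁿ-refl (σ i))

  ≈ⁿ-sym : ∀ σ τ → p ⊩ σ ≈ⁿ τ → p ⊩ τ ≈ⁿ σ
  ≈ⁿ-sym (name I σ s) (name J τ t) (f , g) = g , f

  ≈ⁿ-trans : ∀ ρ σ τ → p ⊩ ρ ≈ⁿ σ → p ⊩ σ ≈ⁿ τ → p ⊩ ρ ≈ⁿ τ
  ≈ⁿ-trans (name I ρ r) (name J σ s) (name K τ t) (f , g) (h , k) =
      (λ i q q≤p q≤r → dense-bind (f i q q≤p q≤r) λ { {u} u≤q (j , u≤s , e) →
         dense-map (h j u (⊑-trans u≤q q≤p) u≤s) λ { v≤u (l , v≤t , e′) →
           l , v≤t , ≈ⁿ-trans (ρ i) (σ j) (τ l) (≈ⁿ-mono (ρ i) (σ j) e v≤u) e′ } })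
    , (λ l q q≤p q≤t → dense-bind (k l q q≤p q≤t) λ { {u} u≤q (j , u≤s , e) →
         dense-map (g j u (⊑-trans u≤q q≤p) u≤s) λ { v≤u (i , v≤r , e′) →
           i , v≤r , ≈ⁿ-trans (τ l) (σ j) (ρ i) (≈ⁿ-mono (τ l) (σ j) e v≤u) e′ } })

  ∈ⁿ-respˡ : ∀ π ρ τ → p ⊩ π ≈ⁿ ρ → p ⊩ π ∈ⁿ τ → p ⊩ ρ ∈ⁿ τ
  ∈ⁿ-respˡ π ρ (name J τ t) e h = dense-map h λ { q≤p (j , q≤t , e′) →
    j , q≤t , ≈ⁿ-trans ρ π (τ j) (≈ⁿ-sym π ρ (≈ⁿ-mono π ρ e q≤p)) e′ }

  ∈ⁿ-respʳ : ∀ π σ τ → p ⊩ σ ≈ⁿ τ → p ⊩ π ∈ⁿ σ → p ⊩ π ∈ⁿ τ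
  ∈ⁿ-respʳ π (name I σ s) (name J τ t) (f , _) h = dense-bind h λ { {q} q≤p (i , q≤s , e) →
    dense-map (f i q q≤p q≤s) λ { r≤q (j , r≤t , e′) →
      j , r≤t , ≈ⁿ-trans π (σ i) (τ j) (≈ⁿ-mono π (σ i) e r≤q) e′ } }

  ⊩-mono : ∀ φ → p ⊩ φ → q ⊑ p → q ⊩ φ
  ⊩-mono (σ ∈̇ τ)  h q≤p = lift (∈ⁿ-mono σ τ (lower h) q≤p)
  ⊩-mono (σ ≐ τ)  h q≤p = lift (≈ⁿ-mono σ τ (lower h) q≤p)
  ⊩-mono (¬̇ φ)   h q≤p = λ r r≤q → h r (⊑-trans r≤q q≤p)
  ⊩-mono (φ ∧̇ ψ) (h , k) q≤p = ⊩-mono φ h q≤p , ⊩-mono ψ k q≤p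
  ⊩-mono (φ ∨̇ ψ) h q≤p = dense-mono h q≤p
  ⊩-mono (φ ⇒̇ ψ) h q≤p = λ r r≤q → h r (⊑-trans r≤q q≤p)
  ⊩-mono (all φ)  h q≤p = λ x → ⊩-mono (φ x) (h x) q≤p
  ⊩-mono (ex φ)   h q≤p = dense-mono h q≤p

  -- This permits strengthening the condition in the middle of an argument: a witness found only on
  -- a dense set may be used as long as the goal is a formula. The clauses for `∈̇`, `∨̇` and `ex`
  -- have density built in; the others inherit it.
  ⊩-local : ∀ φ → DenseBelow p (_⊩ φ) → p ⊩ φ
  ⊩-local (σ ∈̇ τ)  h = lift (∈ⁿ-local σ τ (dense-map h λ _ → lower))
  ⊩-local (σ ≐ τ)  h = lift (≈ⁿ-local σ τ (dense-map h λ _ → lower))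
  ⊩-local (¬̇ φ)   h q q≤p k =
    let r , r≤q , l = h q q≤p in l r ⊑-refl (⊩-mono φ k r≤q)
  ⊩-local (φ ∧̇ ψ) h = ⊩-local φ (dense-map h λ _ → proj₁) , ⊩-local ψ (dense-map h λ _ → proj₂)
  ⊩-local (φ ∨̇ ψ) h = dense-bind h λ _ k → k
  ⊩-local (φ ⇒̇ ψ) h q q≤p k = ⊩-local ψ λ r r≤q →
    let u , u≤r , l = h r (⊑-trans r≤q q≤p) in
    u , u≤r , l u ⊑-refl (⊩-mono φ k (⊑-trans u≤r r≤q))
  ⊩-local (all φ)  h x = ⊩-local (φ x) (dense-map h λ _ k → k x)
  ⊩-local (ex φ)   h = dense-bind h λ _ k → k

  -- As for _≋_: formulas can be inferred from proofs of p ⊨ φ, but not of p ⊩ φ.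
  infix 1 _⊨_

  record _⊨_ (p : Cond) (φ : Formula Name) : Set (lsuc ℓ) where
    constructor mk⊨
    field un⊨ : p ⊩ φ
  open _⊨_ public

  private
    variable
      φ ψ : Formula Name
      Θ : Name → Formula Name
      σ σ′ τ τ′ υ : Name

  mono : p ⊨ φ → q ⊑ p → q ⊨ φ
  mono {φ = φ} (mk⊨ h) q≤p = mk⊨ (⊩-mono φ h q≤p)

  local : DenseBelow p (_⊨ φ) → p ⊨ φ
  local {φ = φ} h = mk⊨ (⊩-local φ (dense-map h λ _ → un⊨))

  ≐-refl : p ⊨ σ ≐ σ
  ≐-refl {σ = σ} = mk⊨ (lift (≈ⁿ-refl σ))

  ≐-sym : p ⊨ σ ≐ τ → p ⊨ τ ≐ σ
  ≐-sym {σ = σ} {τ} (mk⊨ (lift e)) = mk⊨ (lift (≈ⁿ-sym σ τ e))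

  ≐-trans : p ⊨ σ ≐ τ → p ⊨ τ ≐ υ → p ⊨ σ ≐ υ
  ≐-trans {σ = σ} {τ} {υ} (mk⊨ (lift e)) (mk⊨ (lift f)) = mk⊨ (lift (≈ⁿ-trans σ τ υ e f))

  ∈-respˡ : p ⊨ σ ≐ σ′ → p ⊨ σ ∈̇ τ → p ⊨ σ′ ∈̇ τ
  ∈-respˡ {σ = σ} {σ′} {τ} (mk⊨ (lift e)) (mk⊨ (lift h)) = mk⊨ (lift (∈ⁿ-respˡ σ σ′ τ e h))

  ∈-respʳ : p ⊨ τ ≐ τ′ → p ⊨ σ ∈̇ τ → p ⊨ σ ∈̇ τ′
  ∈-respʳ {τ = τ} {τ′} {σ} (mk⊨ (lift e)) (mk⊨ (lift h)) = mk⊨ (lift (∈ⁿ-respʳ σ τ τ′ e h))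

  ∧I : p ⊨ φ → p ⊨ ψ → p ⊨ φ ∧̇ ψ
  ∧I (mk⊨ h) (mk⊨ k) = mk⊨ (h , k)

  ∧E₁ : p ⊨ φ ∧̇ ψ → p ⊨ φ
  ∧E₁ (mk⊨ h) = mk⊨ (proj₁ h)

  ∧E₂ : p ⊨ φ ∧̇ ψ → p ⊨ ψ
  ∧E₂ (mk⊨ h) = mk⊨ (proj₂ h)

  ⇒I : (∀ {q} → q ⊑ p → q ⊨ φ → q ⊨ ψ) → p ⊨ φ ⇒̇ ψ
  ⇒I h = mk⊨ λ q q≤p k → un⊨ (h q≤p (mk⊨ k))

  ⇒E : p ⊨ φ ⇒̇ ψ → p ⊨ φ → p ⊨ ψ
  ⇒E (mk⊨ h) (mk⊨ k) = mk⊨ (h _ ⊑-refl k)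

  ¬I : (∀ {q} → q ⊑ p → q ⊨ φ → ⊥) → p ⊨ ¬̇ φ
  ¬I h = mk⊨ λ q q≤p k → h q≤p (mk⊨ k)

  ¬E : p ⊨ ¬̇ φ → p ⊨ φ → ⊥
  ¬E (mk⊨ h) (mk⊨ k) = h _ ⊑-refl k

  ∀I : (∀ x → p ⊨ Θ x) → p ⊨ all Θ
  ∀I h = mk⊨ λ x → un⊨ (h x)

  ∀E : p ⊨ all Θ → ∀ x → p ⊨ Θ x
  ∀E (mk⊨ h) x = mk⊨ (h x)

  ∃I-dense : DenseBelow p (λ q → ∃ λ x → q ⊨ Θ x) → p ⊨ ex Θ
  ∃I-dense h = mk⊨ (dense-map h λ _ (x , k) → x , un⊨ k)

  ∃I : ∀ x → p ⊨ Θ x → p ⊨ ex Θ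
  ∃I x h = ∃I-dense (dense-all λ q≤p → x , mono h q≤p)

  ∃E : p ⊨ ex Θ → DenseBelow p (λ q → ∃ λ x → q ⊨ Θ x)
  ∃E (mk⊨ h) = dense-map h λ _ (x , k) → x , mk⊨ k

  ∨I-dense : DenseBelow p (λ q → (q ⊨ φ) ⊎ (q ⊨ ψ)) → p ⊨ φ ∨̇ ψ
  ∨I-dense h = mk⊨ (dense-map h λ _ → λ { (inj₁ k) → inj₁ (un⊨ k) ; (inj₂ k) → inj₂ (un⊨ k) })

  ∨I₁ : p ⊨ φ → p ⊨ φ ∨̇ ψ
  ∨I₁ h = ∨I-dense (dense-all λ q≤p → inj₁ (mono h q≤p))

  ∨I₂ : p ⊨ ψ → p ⊨ φ ∨̇ ψ
  ∨I₂ h = ∨I-dense (dense-all λ q≤p → inj₂ (mono h q≤p))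

  ∨E : p ⊨ φ ∨̇ ψ → DenseBelow p (λ q → (q ⊨ φ) ⊎ (q ⊨ ψ))
  ∨E (mk⊨ h) = dense-map h λ _ → λ { (inj₁ k) → inj₁ (mk⊨ k) ; (inj₂ k) → inj₂ (mk⊨ k) }

  ∨-case : p ⊨ φ ∨̇ ψ → ∀ {χ} → (∀ {q} → q ⊑ p → q ⊨ φ → q ⊨ χ) → (∀ {q} → q ⊑ p → q ⊨ ψ → q ⊨ χ) → p ⊨ χ
  ∨-case h f g = local (dense-map (∨E h) λ q≤p → λ { (inj₁ k) → f q≤p k ; (inj₂ k) → g q≤p k })

  ∀∈I : (∀ {q} → q ⊑ p → ∀ x → q ⊨ x ∈̇ σ → q ⊨ Θ x) → p ⊨ all∈ σ Θ
  ∀∈I h = ∀I λ x → ⇒I λ q≤p k → h q≤p x k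

  ∀∈E : p ⊨ all∈ σ Θ → ∀ {x} → p ⊨ x ∈̇ σ → p ⊨ Θ x
  ∀∈E h k = ⇒E (∀E h _) k

  ∃∈I : ∀ x → p ⊨ x ∈̇ σ → p ⊨ Θ x → p ⊨ ex∈ σ Θ
  ∃∈I x h k = ∃I x (∧I h k)

  ∃∈E : p ⊨ ex∈ σ Θ → DenseBelow p (λ q → ∃ λ x → (q ⊨ x ∈̇ σ) × (q ⊨ Θ x))
  ∃∈E h = dense-map (∃E h) λ _ (x , k) → x , ∧E₁ k , ∧E₂ k

  ∈-name : ∀ {I} {ν : I → Name} {s : I → Cond} i → p ⊑ s i → p ⊨ ν i ∈̇ name I ν s
  ∈-name {ν = ν} i p≤s = mk⊨ (lift λ q q≤p → q , ⊑-refl , i , ⊑-trans q≤p p≤s , ≈ⁿ-refl (ν i))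

  ∈-name⁻ : ∀ {I} {ν : I → Name} {s : I → Cond} → p ⊨ σ ∈̇ name I ν s →
            DenseBelow p (λ q → ∃ λ i → q ⊑ s i × (q ⊨ σ ≐ ν i))
  ∈-name⁻ (mk⊨ (lift h)) = dense-map h λ _ (i , q≤s , e) → i , q≤s , mk⊨ (lift e)

  ⊆-antisym : p ⊨ σ ⊆̇ τ → p ⊨ τ ⊆̇ σ → p ⊨ σ ≐ τ
  ⊆-antisym {σ = name I σ s} {name J τ t} h k = mk⊨ (lift
    ( (λ i q q≤p q≤s → lower (un⊨ (∀∈E (mono h q≤p) (∈-name i q≤s))))
    , (λ j q q≤p q≤t → lower (un⊨ (∀∈E (mono k q≤p) (∈-name j q≤t)))) ))

  ∈-check⁻ : ∀ {x} → p ⊨ σ ∈̇ check x → DenseBelow p (λ q → ∃ λ i → q ⊨ σ ≐ check (el x i))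
  ∈-check⁻ {x = sup I x} h = dense-map (∈-name⁻ h) λ _ ((i , _) , _ , e) → i , e

  ∈-check-el : ∀ {x} i → p ⊨ check (el x i) ∈̇ check x
  ∈-check-el {p = p} {x = sup I x} i = ∈-name (i , p) ⊑-refl

  check-≐ : ∀ {x y} → x ≋ y → p ⊨ check x ≐ check y
  check-≐ {x = sup I x} {sup J y} (mk≋ (f , g)) = ⊆-antisym
    (∀∈I λ _ _ h → local (dense-map (∈-check⁻ {x = sup I x} h) λ _ (i , e) →
      let j , k = f i in ∈-respˡ (≐-sym (≐-trans e (check-≐ {x = x i} {y j} (mk≋ k)))) (∈-check-el {x = sup J y} j)))
    (∀∈I λ _ _ h → local (dense-map (∈-check⁻ {x = sup J y} h) λ _ (j , e) →
      let i , k = g j in ∈-respˡ (≐-sym (≐-trans e (≐-sym (check-≐ {x = x i} {y j} (mk≋ k))))) (∈-check-el {x = sup I x} i)))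

  check-∈ : ∀ {x y} → x ∊ y → p ⊨ check x ∈̇ check y
  check-∈ h = let i , e = ∊-index h in ∈-respˡ (≐-sym (check-≐ e)) (∈-check-el i)

  -- The conclusion is a fact about V and mentions no condition, so each element may be located at a
  -- single condition below `p`.
  check-≐⁻ : ∀ x y → p ⊨ check x ≐ check y → x ≋ y
  check-≐⁻ {p} x@(sup I f) y@(sup J g) e = ≋-ext
    (λ i → let _ , _ , j , k = dense-here (∈-check⁻ (∈-respʳ e (∈-check-el {x = x} i)))
           in ∊-intro j (check-≐⁻ (f i) (g j) k))
    (λ j → let _ , _ , i , k = dense-here (∈-check⁻ (∈-respʳ (≐-sym e) (∈-check-el {x = y} j)))
           in ∊-intro i (≋-sym (check-≐⁻ (f i) (g j) (≐-sym k))))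

  check-∈⁻ : ∀ {x y} → p ⊨ check x ∈̇ check y → x ∊ y
  check-∈⁻ {x = x} {y} h = let _ , _ , i , e = dense-here (∈-check⁻ h) in ∊-intro i (check-≐⁻ x (el y i) e)

  -- Foundation, by recursion on the name: a `σ` belonging to itself equals one of its listed
  -- members `ν i`, which then belongs to a set equal to it.
  ∈-irrefl : ∀ σ → p ⊨ τ ≐ σ → p ⊨ σ ∈̇ τ → ⊥
  ∈-irrefl {τ = τ} (name I ν s) e h =
    let q , q≤p , i , q≤s , f = dense-here (∈-name⁻ (∈-respʳ e h))
    in ∈-irrefl (ν i) f (∈-name i q≤s)

  eval-resp : ∀ φ k {ρ ρ′} → (∀ j → p ⊨ ρ j ≐ ρ′ j) → p ⊨ eval k φ ρ → p ⊨ eval k φ ρ′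
  eval-resp (i ∈̇ j)  k e h = ∈-respˡ (e i) (∈-respʳ (e j) h)
  eval-resp (i ≐ j)  k e h = ≐-trans (≐-sym (e i)) (≐-trans h (e j))
  eval-resp (¬̇ φ)   k e h = ¬I λ q≤p l →
    ¬E (mono h q≤p) (eval-resp φ k (λ j → ≐-sym (mono (e j) q≤p)) l)
  eval-resp (φ ∧̇ ψ) k e h = ∧I (eval-resp φ k e (∧E₁ h)) (eval-resp ψ k e (∧E₂ h))
  eval-resp (φ ∨̇ ψ) k e h = ∨I-dense (dense-map (∨E h) λ q≤p → λ
    { (inj₁ l) → inj₁ (eval-resp φ k (λ j → mono (e j) q≤p) l)
    ; (inj₂ l) → inj₂ (eval-resp ψ k (λ j → mono (e j) q≤p) l) })
  eval-resp (φ ⇒̇ ψ) k e h = ⇒I λ q≤p l → eval-resp ψ k (λ j → mono (e j) q≤p)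
    (⇒E (mono h q≤p) (eval-resp φ k (λ j → ≐-sym (mono (e j) q≤p)) l))
  eval-resp (all φ)  k e h = ∀I λ x → eval-resp (φ k) (suc k) (update-rel (λ σ τ → _ ⊨ σ ≐ τ) k e ≐-refl) (∀E h x)
  eval-resp (ex φ)   k e h = ∃I-dense (dense-map (∃E h) λ q≤p (x , l) →
    x , eval-resp (φ k) (suc k) (update-rel (λ σ τ → _ ⊨ σ ≐ τ) k (λ j → mono (e j) q≤p) ≐-refl) l)

  -- For a concrete formula `eval` computes away, and these types reduce to ordinary instances such
  -- as `finite σ`. Unification cannot invert that computation, hence the names supplied explicitly
  -- at the uses.
  resp₁ : (φ : ℕ → Formula ℕ) → p ⊨ σ ≐ σ′ → p ⊨ eval 1 (φ 0) (env₁ σ) → p ⊨ eval 1 (φ 0) (env₁ σ′)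
  resp₁ φ e = eval-resp (φ 0) 1 λ _ → e

  resp₂ : (φ : ℕ → ℕ → Formula ℕ) → p ⊨ σ ≐ σ′ → p ⊨ τ ≐ τ′ →
          p ⊨ eval 2 (φ 0 1) (env₂ σ τ) → p ⊨ eval 2 (φ 0 1) (env₂ σ′ τ′)
  resp₂ φ e f = eval-resp (φ 0 1) 2 λ { zero → e ; (suc _) → f }

  resp₃ : ∀ {ν ν′} (φ : ℕ → ℕ → ℕ → Formula ℕ) → p ⊨ σ ≐ σ′ → p ⊨ τ ≐ τ′ → p ⊨ ν ≐ ν′ →
          p ⊨ eval 3 (φ 0 1 2) (env₃ σ τ ν) → p ⊨ eval 3 (φ 0 1 2) (env₃ σ′ τ′ ν′)
  resp₃ φ e f g = eval-resp (φ 0 1 2) 3 λ { zero → e ; (suc zero) → f ; (suc (suc _)) → g }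

  resp₄ : ∀ {ν ν′ π π′} (φ : ℕ → ℕ → ℕ → ℕ → Formula ℕ) → p ⊨ σ ≐ σ′ → p ⊨ τ ≐ τ′ → p ⊨ ν ≐ ν′ → p ⊨ π ≐ π′ →
          p ⊨ eval 4 (φ 0 1 2 3) (env₄ σ τ ν π) → p ⊨ eval 4 (φ 0 1 2 3) (env₄ σ′ τ′ ν′ π′)
  resp₄ φ e f g h = eval-resp (φ 0 1 2 3) 4
    λ { zero → e ; (suc zero) → f ; (suc (suc zero)) → g ; (suc (suc (suc _))) → h }

  mutual
    -- Below a dense set of conditions a member of a check name is itself a check name; this settles
    -- bounded universal quantifiers, and `local` returns to `p`. Existential witnesses are carried
    -- over by `check`.
    absolute↑ : ∀ {φ k ρ ρ′} → Pol up k φ → (∀ j → p ⊨ ρ′ j ≐ check (ρ j)) → V⊨ eval k φ ρ → p ⊨ eval k φ ρ′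
    absolute↑ (mem {i = i} {j}) e h = ∈-respˡ (≐-sym (e i)) (∈-respʳ (≐-sym (e j)) (check-∈ (∊↓ h)))
    absolute↑ (equ {i = i} {j}) e h = ≐-trans (e i) (≐-trans (check-≐ (mk≋ (lower h))) (≐-sym (e j)))
    absolute↑ (neg d) e h = ¬I λ q≤p k → h (absolute↓ d (λ j → mono (e j) q≤p) k)
    absolute↑ (and c d) e (h , k) = ∧I (absolute↑ c e h) (absolute↑ d e k)
    absolute↑ (or c d) e (inj₁ h) = ∨I₁ (absolute↑ c e h)
    absolute↑ (or c d) e (inj₂ h) = ∨I₂ (absolute↑ d e h)
    absolute↑ (imp c d) e h = ⇒I λ q≤p k →
      absolute↑ d (λ j → mono (e j) q≤p) (h (absolute↓ c (λ j → mono (e j) q≤p) k))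
    absolute↑ {k = k} (∃↑ d) e (x , h) =
      ∃I (check x) (absolute↑ d (update-rel (λ y σ → _ ⊨ σ ≐ check y) k e ≐-refl) h)
    absolute↑ {k = k} {ρ} {ρ′} (∀∈ {b = b} {ψ} eq b≢k d) e h = ∀I λ τ →
      subst (λ χ → _ ⊨ eval (suc k) χ (update ρ′ k τ)) (sym eq) (⇒I λ {q} q≤p m →
        local (dense-map (∈-check⁻ (∈-respʳ (mono (e b) q≤p)
                 (subst₂ (λ u v → q ⊨ u ∈̇ v) (update-same ρ′ k τ) (update-other ρ′ k τ b≢k) m)))
          λ {r} r≤q (i , f) → absolute↑ d
            (update-rel (λ y σ → r ⊨ σ ≐ check y) k (λ j → mono (e j) (⊑-trans r≤q q≤p)) f)
            (subst (λ χ → V⊨ eval (suc k) χ (update ρ k (el (ρ b) i))) eq (h (el (ρ b) i))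
              (∊↑ (subst₂ _∊_ (sym (update-same ρ k _)) (sym (update-other ρ k _ b≢k)) (∊-el i))))))

    -- Truth in V does not vary with the condition, so disjunctions and bounded existentials are
    -- read off at any one condition below `p` that decides them.
    absolute↓ : ∀ {φ k ρ ρ′} → Pol dn k φ → (∀ j → p ⊨ ρ′ j ≐ check (ρ j)) → p ⊨ eval k φ ρ′ → V⊨ eval k φ ρ
    absolute↓ (mem {i = i} {j}) e h = ∊↑ (check-∈⁻ (∈-respˡ (e i) (∈-respʳ (e j) h)))
    absolute↓ (equ {i = i} {j}) e h = lift (un≋ (check-≐⁻ _ _ (≐-trans (≐-sym (e i)) (≐-trans h (e j)))))
    absolute↓ (neg d) e h k = ¬E h (absolute↑ d e k)
    absolute↓ (and c d) e h = absolute↓ c e (∧E₁ h) , absolute↓ d e (∧E₂ h)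
    absolute↓ (or c d) e h with dense-here (∨E h)
    ... | q , q≤p , inj₁ k = inj₁ (absolute↓ c (λ j → mono (e j) q≤p) k)
    ... | q , q≤p , inj₂ k = inj₂ (absolute↓ d (λ j → mono (e j) q≤p) k)
    absolute↓ (imp c d) e h k = absolute↓ d e (⇒E h (absolute↑ c e k))
    absolute↓ {k = k} (∀↓ d) e h x =
      absolute↓ d (update-rel (λ y σ → _ ⊨ σ ≐ check y) k e ≐-refl) (∀E h (check x))
    absolute↓ {k = k} {ρ} {ρ′} (∃mem {b = b} eq b≢k) e h =
      let q , q≤p , τ , l = dense-here (∃E h)
          l′ = subst (λ χ → q ⊨ eval (suc k) χ (update ρ′ k τ)) eq l
          r , r≤q , i , f = dense-here (∈-check⁻ (∈-respʳ (mono (e b) q≤p)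
                 (subst₂ (λ u v → q ⊨ u ∈̇ v) (update-same ρ′ k τ) (update-other ρ′ k τ b≢k) l′)))
      in el (ρ b) i , subst (λ χ → V⊨ eval (suc k) χ (update ρ k (el (ρ b) i))) (sym eq)
           (∊↑ (subst₂ _∊_ (sym (update-same ρ k _)) (sym (update-other ρ k _ b≢k)) (∊-el i)))
    absolute↓ {k = k} {ρ} {ρ′} (∃∈ {b = b} {ψ} eq b≢k d) e h =
      let q , q≤p , τ , l = dense-here (∃E h)
          l′ = subst (λ χ → q ⊨ eval (suc k) χ (update ρ′ k τ)) eq l
          r , r≤q , i , f = dense-here (∈-check⁻ (∈-respʳ (mono (e b) q≤p)
                 (subst₂ (λ u v → q ⊨ u ∈̇ v) (update-same ρ′ k τ) (update-other ρ′ k τ b≢k) (∧E₁ l′))))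
      in el (ρ b) i , subst (λ χ → V⊨ eval (suc k) χ (update ρ k (el (ρ b) i))) (sym eq)
           ( ∊↑ (subst₂ _∊_ (sym (update-same ρ k _)) (sym (update-other ρ k _ b≢k)) (∊-el i))
           , absolute↓ d (update-rel (λ y σ → r ⊨ σ ≐ check y) k (λ j → mono (e j) (⊑-trans r≤q q≤p)) f)
               (mono (∧E₂ l′) r≤q))

  ω-forced : p ⊨ isω (check ω)
  ω-forced = absolute↑ {φ = isω 0} {1} {env₁ ω} (and limit↑ (∀∈ refl refl (neg limit↓))) (λ _ → ≐-refl) ω-isω
    where
    limit↑ : Pol up 1 (limit 0)
    limit↑ = and ordinal↑ (and (∃↑ mem) (∀∈ refl refl (∃↑ (and mem mem))))
    limit↓ : Pol dn 2 (limit 1)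
    limit↓ = and (and transitive↓ (∀↓ (imp mem transitive↓))) (and (∃mem refl refl) (∀↓ (imp mem (∃∈ refl refl mem))))

-- Ordered pairs, functions and natural numbers in the extension

module Functions {ℓ} (P : Poset ℓ ℓ ℓ) where

  open Names P

  private
    variable
      p q : Cond
      s t u u′ v v′ x y z : Name

  isPair-∈ : p ⊨ isPair z x y → p ⊨ u ∈̇ z → p ⊨ u ≐ x ∨̇ u ≐ y
  isPair-∈ h k = ⇒E (∧E₁ (∀E h _)) k

  isPair-∈ˡ : p ⊨ isPair z x y → p ⊨ x ∈̇ z
  isPair-∈ˡ h = ⇒E (∧E₂ (∀E h _)) (∨I₁ ≐-refl)

  isPair-∈ʳ : p ⊨ isPair z x y → p ⊨ y ∈̇ z
  isPair-∈ʳ h = ⇒E (∧E₂ (∀E h _)) (∨I₂ ≐-refl)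

  isSingleton-∈ : p ⊨ isPair z x x → p ⊨ u ∈̇ z → p ⊨ u ≐ x
  isSingleton-∈ h k = ∨-case (isPair-∈ h k) (λ _ e → e) (λ _ e → e)

  isOrderedPair-resp : p ⊨ z ≐ y → p ⊨ isOrderedPair z u v → p ⊨ isOrderedPair y u v
  isOrderedPair-resp {z = z} {y} {u} {v} e = resp₃ {σ = z} {y} {u} {u} {v} {v} isOrderedPair e ≐-refl ≐-refl

  maps-resp : p ⊨ u ≐ u′ → p ⊨ v ≐ v′ → p ⊨ maps z u v → p ⊨ maps z u′ v′
  maps-resp {u = u} {u′} {v} {v′} {z} e f = resp₃ {σ = z} {z} {u} {u′} {v} {v′} maps ≐-refl e f

  Kuratowski : Name → Name → Name → Name → Name → Formula Name
  Kuratowski z u v s t = isPair s u u ∧̇ isPair t u v ∧̇ isPair z s t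

  -- The singleton of `u` is one of `s′`, `t′`, and both of these contain `u′`.
  kuratowski-fst : p ⊨ Kuratowski z u v s t → ∀ {s′ t′} → p ⊨ Kuratowski z u′ v′ s′ t′ → p ⊨ u′ ≐ u
  kuratowski-fst h k = isSingleton-∈ (∧E₁ h) (∨-case (isPair-∈ (∧E₂ (∧E₂ k)) (isPair-∈ˡ (∧E₂ (∧E₂ h))))
    (λ q≤p e → ∈-respʳ (≐-sym e) (isPair-∈ˡ (∧E₁ (mono k q≤p))))
    (λ q≤p e → ∈-respʳ (≐-sym e) (isPair-∈ˡ (∧E₁ (∧E₂ (mono k q≤p))))))

  kuratowski-snd : p ⊨ Kuratowski z u v s t → ∀ {s′ t′} → p ⊨ Kuratowski z u′ v′ s′ t′ → p ⊨ v ≐ u′ ∨̇ v ≐ v′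
  kuratowski-snd h k = ∨-case (isPair-∈ (∧E₂ (∧E₂ k)) (isPair-∈ʳ (∧E₂ (∧E₂ h))))
    (λ q≤p e → ∨I₁ (isSingleton-∈ (∧E₁ (mono k q≤p)) (∈-respʳ e (isPair-∈ʳ (∧E₁ (∧E₂ (mono h q≤p)))))))
    (λ q≤p e → isPair-∈ (∧E₁ (∧E₂ (mono k q≤p))) (∈-respʳ e (isPair-∈ʳ (∧E₁ (∧E₂ (mono h q≤p))))))

  isOrderedPair-injective : ∀ {p z u v u′ v′} → p ⊨ isOrderedPair z u v → p ⊨ isOrderedPair z u′ v′ → p ⊨ u ≐ u′ ∧̇ v ≐ v′
  isOrderedPair-injective h k = local
    (dense-bind (∃E h) λ q≤p (s , h₁) → dense-bind (∃E h₁) λ r≤q (t , h₂) →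
     dense-bind (∃E (mono k (⊑-trans r≤q q≤p))) λ a≤r (s′ , k₁) → dense-map (∃E k₁) λ b≤a (t′ , k₂) →
     both (mono h₂ (⊑-trans b≤a a≤r)) k₂)
    where
    both : ∀ {s t s′ t′} → q ⊨ Kuratowski z u v s t → q ⊨ Kuratowski z u′ v′ s′ t′ → q ⊨ u ≐ u′ ∧̇ v ≐ v′
    -- If `v` is `u′`, the symmetric lemma makes `v′` equal to `u` or to `v`; in the first case `v`,
    -- `u′`, `u`, `v′` all coincide.
    both h k = ∧I (kuratowski-fst k h) (∨-case (kuratowski-snd h k)
      (λ q≤p e → ∨-case (kuratowski-snd (mono k q≤p) (mono h q≤p))
        (λ r≤q f → ≐-trans (mono e r≤q) (≐-trans (kuratowski-fst (mono h (⊑-trans r≤q q≤p)) (mono k (⊑-trans r≤q q≤p))) (≐-sym f)))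
        (λ _ f → ≐-sym f))
      (λ _ e → e))

  -- As with `check`, every condition is attached to each member, since a largest one may not exist.
  upair : Name → Name → Name
  upair σ τ = name (Lift ℓ Bool × Cond) (λ (b , _) → if lower b then σ else τ) proj₂

  upair-isPair : p ⊨ isPair (upair x y) x y
  upair-isPair {x = x} {y} = ∀I λ u → ∧I
    (⇒I λ _ h → ∨I-dense (dense-map (∈-name⁻ h) λ
      { _ ((lift true , _) , _ , e) → inj₁ e ; _ ((lift false , _) , _ , e) → inj₂ e }))
    (⇒I λ {q} _ h → ∨-case h
      (λ _ e → ∈-respˡ (≐-sym e) (∈-name (lift true , _) ⊑-refl))
      (λ _ e → ∈-respˡ (≐-sym e) (∈-name (lift false , _) ⊑-refl)))

  opair : Name → Name → Name
  opair σ τ = upair (upair σ σ) (upair σ τ)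

  opair-isOrderedPair : p ⊨ isOrderedPair (opair x y) x y
  opair-isOrderedPair = ∃I _ (∃I _ (∧I upair-isPair (∧I upair-isPair upair-isPair)))

  isOrderedPair-opair : ∀ {p x y z u v} → p ⊨ z ≐ opair x y → p ⊨ isOrderedPair z u v → p ⊨ u ≐ x ∧̇ v ≐ y
  isOrderedPair-opair {p} {x} {y} {z} {u} {v} e k =
    isOrderedPair-injective {p} {z} {u} {v} {x} {y} k
      (isOrderedPair-resp {y = z} {u = x} {v = y} (≐-sym e) (opair-isOrderedPair {x = x} {y}))

  -- `R q i j` stands for "`q` forces `σ i` to be sent to `τ j`". Its values lie in `Set ℓ`, so the
  -- triples it admits can index a name.
  module Graph {I J : Set ℓ} (σ : I → Name) (τ : J → Name) (R : Cond → I → J → Set ℓ)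
               (R-mono : ∀ {p q i j} → R p i j → q ⊑ p → R q i j) where

    graph : Name
    graph = name (Σ I λ i → Σ J λ j → Σ Cond λ r → R r i j)
                 (λ (i , j , _) → opair (σ i) (τ j)) (λ (_ , _ , r , _) → r)

    maps-graph : ∀ {i j} → R p i j → p ⊨ u ≐ σ i → p ⊨ v ≐ τ j → p ⊨ maps graph u v
    maps-graph {p} {i = i} {j} r e f = maps-resp (≐-sym e) (≐-sym f)
      (∃∈I (opair (σ i) (τ j)) (∈-name (i , j , p , r) ⊑-refl) (opair-isOrderedPair {x = σ i} {τ j}))

    maps-graph⁻ : p ⊨ maps graph u v →
                  DenseBelow p (λ q → ∃ λ i → ∃ λ j → R q i j × (q ⊨ u ≐ σ i) × (q ⊨ v ≐ τ j))
    maps-graph⁻ {p} {u} {v} h = dense-bind (∃∈E {σ = graph} {Θ = λ z → isOrderedPair z u v} h)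
      λ _ (z , z∈ , k) → member z∈ k
      where
      components :  ∀ {p q z i j} → q ⊑ p → p ⊨ isOrderedPair z u v → q ⊨ z ≐ opair (σ i) (τ j) → (q ⊨ u ≐ σ i) × (q ⊨ v ≐ τ j)
      components q≤p k e = let m = isOrderedPair-opair e (mono k q≤p) in ∧E₁ m , ∧E₂ m
      member : ∀ {q z} → q ⊨ z ∈̇ graph → q ⊨ isOrderedPair z u v →
               DenseBelow q (λ r → ∃ λ i → ∃ λ j → R r i j × (r ⊨ u ≐ σ i) × (r ⊨ v ≐ τ j))
      member z∈ k = dense-map (∈-name⁻ z∈) λ q≤p ((i , j , _ , r) , q≤r , e) → i , j , R-mono r q≤r , components q≤p k e

    module _ {p X Y}
      (dom : ∀ {q i j} → q ⊑ p → R q i j → q ⊨ σ i ∈̇ X)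
      (cod : ∀ {q i j} → q ⊑ p → R q i j → q ⊨ τ j ∈̇ Y)
      (total : ∀ {q u} → q ⊑ p → q ⊨ u ∈̇ X → DenseBelow q (λ r → ∃ λ i → ∃ λ j → R r i j × (r ⊨ u ≐ σ i)))
      (functional : ∀ {q i j i′ j′} → q ⊑ p → R q i j → R q i′ j′ → q ⊨ σ i ≐ σ i′ → q ⊨ τ j ≐ τ j′)
      (injective : ∀ {q i j i′ j′} → q ⊑ p → R q i j → R q i′ j′ → q ⊨ τ j ≐ τ j′ → q ⊨ σ i ≐ σ i′)
      where

      graph-function : p ⊨ isFunction graph X Y
      graph-function = ∧I
        (∀∈I λ q≤p z z∈ → local (dense-map (∈-name⁻ z∈) λ r≤q ((i , j , _ , r) , r≤s , e) →
          let r′ = R-mono r r≤s ; r≤p = ⊑-trans r≤q q≤p in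
          ∃∈I (σ i) (dom r≤p r′) (∃∈I (τ j) (cod r≤p r′)
            (isOrderedPair-resp (≐-sym e) (opair-isOrderedPair {x = σ i} {τ j})))))
        (∀∈I λ q≤p u u∈ → local (dense-map (total q≤p u∈) λ r≤q (i , j , r , e) →
          let r≤p = ⊑-trans r≤q q≤p in
          ∃∈I (τ j) (cod r≤p r) (∧I (maps-graph r e ≐-refl)
            (∀I λ v′ → ⇒I λ a≤r m → local (dense-map (maps-graph⁻ m) λ b≤a (i′ , j′ , r′ , e′ , f′) →
              let b≤r = ⊑-trans b≤a a≤r in
              ≐-trans f′ (functional (⊑-trans b≤r r≤p) r′ (R-mono r b≤r)
                (≐-trans (≐-sym e′) (mono e b≤r))))))))

      graph-injection : p ⊨ isInjection graph X Y
      graph-injection = ∧I graph-function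
        (∀∈I λ q≤p u u∈ → ∀∈I λ r≤q u′ u′∈ → ∀I λ v → ⇒I λ a≤r m →
          local (dense-bind (maps-graph⁻ (∧E₁ m)) λ b≤a (i , j , r , e , f) →
                 dense-map (maps-graph⁻ (mono (∧E₂ m) b≤a)) λ c≤b (i′ , j′ , r′ , e′ , f′) →
                 ≐-trans (mono e c≤b) (≐-trans
                   (injective (⊑-trans c≤b (⊑-trans b≤a (⊑-trans a≤r (⊑-trans r≤q q≤p))))
                     (R-mono r c≤b) r′ (≐-trans (≐-sym (mono f c≤b)) f′))
                   (≐-sym e′))))

      graph-bijection : (∀ {q v} → q ⊑ p → q ⊨ v ∈̇ Y → DenseBelow q (λ r → ∃ λ i → ∃ λ j → R r i j × (r ⊨ v ≐ τ j))) →
                        p ⊨ isBijection graph X Y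
      graph-bijection surjective = ∧I graph-injection
        (∀∈I λ q≤p v v∈ → local (dense-map (surjective q≤p v∈) λ r≤q (i , j , r , e) →
          ∃∈I (σ i) (dom (⊑-trans r≤q q≤p) r) (maps-graph r ≐-refl e)))

module Naturals {ℓ} (em : ExcludedMiddle (lsuc ℓ)) (P : Poset ℓ ℓ ℓ) where

  open Names P
  open Functions P

  private
    variable
      p q : Cond
      φ : Formula Name
      σ τ : Name
      Θ : Name → Formula Name

  decide : ∀ p φ → (∃ λ q → q ⊑ p × (q ⊨ φ)) ⊎ (p ⊨ ¬̇ φ)
  decide p φ with em {∃ λ q → q ⊑ p × (q ⊨ φ)}
  ... | yes h = inj₁ h
  ... | no ¬h = inj₂ (¬I λ q≤p h → ¬h (_ , q≤p , h))

  by-cases : ∀ φ → DenseBelow p (λ q → (q ⊨ φ) ⊎ (q ⊨ ¬̇ φ))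
  by-cases φ q q≤p with decide q φ
  ... | inj₁ (r , r≤q , h) = r , r≤q , inj₁ h
  ... | inj₂ h             = q , ⊑-refl , inj₂ h

  ⊨-stable : ¬ (∃ λ q → q ⊑ p × (q ⊨ ¬̇ φ)) → p ⊨ φ
  ⊨-stable {φ = φ} h = local λ q q≤p → [ (λ r → r) , (λ k → ⊥-elim (h (q , q≤p , k))) ]′ (decide q φ)

  ¬∀∈ : ¬ (p ⊨ all∈ σ Θ) → ∃ λ q → q ⊑ p × ∃ λ x → (q ⊨ x ∈̇ σ) × (q ⊨ ¬̇ Θ x)
  ¬∀∈ {p} {σ} {Θ} h with em {∃ λ q → q ⊑ p × ∃ λ x → (q ⊨ x ∈̇ σ) × (q ⊨ ¬̇ Θ x)}
  ... | yes k = k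
  ... | no ¬k = ⊥-elim (h (∀∈I λ q≤p x x∈ → ⊨-stable λ (r , r≤q , n) →
                  ¬k (r , ⊑-trans r≤q q≤p , x , mono x∈ r≤q , n)))

  -- A member of ω is 0 or has a largest element, by failure of the limit condition.
  ω-member : ∀ {w} ν → p ⊨ isω w → p ⊨ ν ∈̇ w → DenseBelow p (λ q → ∃ λ n → q ⊨ ν ≐ check (nat n))
  ω-member {w = w} ν@(name I μ s) h ν∈ = λ q q≤p → go (mono h q≤p) (mono ν∈ q≤p)
    where
    transitive-member : ∀ {q x} → q ⊨ isω w → q ⊨ x ∈̇ w → q ⊨ transitive x
    transitive-member h x∈ = ∀∈E (∧E₂ (∧E₁ (∧E₁ h))) x∈
    member-trans : ∀ {q x y} → q ⊨ isω w → q ⊨ x ∈̇ w → q ⊨ y ∈̇ x → q ⊨ y ∈̇ w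
    member-trans h x∈ y∈ = ∀∈E (∀∈E (∧E₁ (∧E₁ (∧E₁ h))) x∈) y∈
    members : ∀ {q y} → q ⊨ isω w → q ⊨ ν ∈̇ w → q ⊨ y ∈̇ ν → DenseBelow q (λ r → ∃ λ n → r ⊨ y ≐ check (nat n))
    members h ν∈ y∈ = dense-bind (∈-name⁻ y∈) λ q≤p (i , _ , e) →
      dense-map (ω-member (μ i) (mono h q≤p) (∈-respˡ e (member-trans (mono h q≤p) (mono ν∈ q≤p) (mono y∈ q≤p))))
        λ r≤q (n , f) → n , ≐-trans (mono e r≤q) f
    go : ∀ {q} → q ⊨ isω w → q ⊨ ν ∈̇ w → ∃ λ r → r ⊑ q × ∃ λ n → r ⊨ ν ≐ check (nat n)
    go {q} h ν∈ with decide q (nonempty ν)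
    ... | inj₂ empty = q , ⊑-refl , 0 , ⊆-antisym
      (∀∈I λ r≤q x x∈ → ⊥-elim (¬E (mono empty r≤q) (∃I x x∈)))
      (∀∈I λ r≤q x x∈ → ⊥-elim (let _ , _ , i , _ = dense-here (∈-check⁻ x∈) in Level.Lift.lower i))
    ... | inj₁ (r , r≤q , ne)
      with a , a≤r , y , y∈ , top ← ¬∀∈ {r} {ν} {λ y → ex∈ ν (λ z → y ∈̇ z)} (λ unb →
             ¬E (∀∈E (∧E₂ (mono h r≤q)) (mono ν∈ r≤q))
               (∧I (∧I (transitive-member (mono h r≤q) (mono ν∈ r≤q))
                       (∀∈I λ b≤r x x∈ → transitive-member (mono h (⊑-trans b≤r r≤q))
                         (member-trans (mono h (⊑-trans b≤r r≤q)) (mono ν∈ (⊑-trans b≤r r≤q)) x∈)))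
                   (∧I ne unb)))
      with b , b≤a , n , e ← dense-here (members (mono h (⊑-trans a≤r r≤q)) (mono ν∈ (⊑-trans a≤r r≤q)) y∈)
      = b , b≤q , suc n , ⊆-antisym
          (∀∈I λ c≤b x x∈ → local (dense-map (members (mono h (⊑-trans c≤b b≤q)) (mono ν∈ (⊑-trans c≤b b≤q)) x∈)
            λ d≤c (m , f) → ∈-respˡ (≐-sym f) (check-∈ (nat-mem {n = suc n} (s≤s (ℕ.≮⇒≥ λ n<m →
              ¬E (mono top (⊑-trans d≤c (⊑-trans c≤b b≤a)))
                (∃∈I x (mono x∈ d≤c) (∈-respʳ (≐-sym f)
                  (∈-respˡ (≐-sym (mono e (⊑-trans d≤c c≤b))) (check-∈ (nat-mem n<m)))))))))))
          (∀∈I λ c≤b x x∈ → local (dense-map (∈-check⁻ x∈) λ d≤c (i , f) →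
            let d≤b = ⊑-trans d≤c c≤b
                m , m<n , g = nat-mem⁻ (suc n) (∊-el {x = nat (suc n)} i)
                y∈′ = mono y∈ (⊑-trans d≤b b≤a)
            in ∈-respˡ (≐-sym (≐-trans f (check-≐ g)))
                 ([ (λ lt → ∀∈E (∀∈E (transitive-member (mono h (⊑-trans d≤b b≤q)) (mono ν∈ (⊑-trans d≤b b≤q))) y∈′)
                      (∈-respʳ (≐-sym (mono e d≤b)) (check-∈ (nat-mem lt))))
                  , (λ m≡n → ∈-respˡ (≐-trans (mono e d≤b) (check-≐ (≡⇒≋ (cong nat (sym m≡n))))) y∈′) ]′ (ℕ.m≤n⇒m<n∨m≡n (ℕ.≤-pred m<n)))))
      where
      b≤q : b ⊑ q
      b≤q = ⊑-trans b≤a (⊑-trans a≤r r≤q)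

-- Cardinality in the extension

module Choice {ℓ} (em : ExcludedMiddle (lsuc ℓ)) (ext : Extensionality (lsuc ℓ) (lsuc ℓ)) where

  em↓ : ExcludedMiddle ℓ
  em↓ {A} with em {Lift (lsuc ℓ) A}
  ... | yes (lift a) = yes a
  ... | no ¬a        = no λ a → ¬a (lift a)

  module _ {I : Set ℓ} where

    -- The element chosen by `em` depends only on a Boolean-valued function, so
    -- by extensionality `pick` gives equal results on equivalent predicates.
    pickᵇ : (I → Bool) → Maybe I
    pickᵇ b with em↓ {Σ I λ i → T (b i)}
    ... | yes (i , _) = just i
    ... | no _        = nothing

    pickᵇ-sound : ∀ b {i} → pickᵇ b ≡ just i → T (b i)
    pickᵇ-sound b eq with em↓ {Σ I λ i → T (b i)}
    pickᵇ-sound b refl | yes (_ , h) = h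

    pickᵇ-complete : ∀ b {i} → T (b i) → ∃ λ j → pickᵇ b ≡ just j
    pickᵇ-complete b h with em↓ {Σ I λ i → T (b i)}
    ... | yes (i , _) = i , refl
    ... | no ¬h       = ⊥-elim (¬h (_ , h))

    truth : (I → Set ℓ) → I → Bool
    truth Q i = does (em↓ {Q i})

    truth-sound : ∀ Q i → T (truth Q i) → Q i
    truth-sound Q i h with em↓ {Q i}
    ... | yes k = k

    truth-complete : ∀ Q i → Q i → T (truth Q i)
    truth-complete Q i k with em↓ {Q i}
    ... | yes _ = tt
    ... | no ¬k = ¬k k

    pick : (I → Set ℓ) → Maybe I
    pick Q = pickᵇ (truth Q)

    pick-sound : ∀ {Q i} → pick Q ≡ just i → Q i
    pick-sound {Q} {i} eq = truth-sound Q i (pickᵇ-sound (truth Q) eq)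

    pick-complete : ∀ {Q i} → Q i → ∃ λ j → pick Q ≡ just j
    pick-complete {Q} {i} h = pickᵇ-complete (truth Q) (truth-complete Q i h)

    pick-cong : ∀ {Q R} → (∀ i → Q i → R i) → (∀ i → R i → Q i) → pick Q ≡ pick R
    pick-cong {Q} {R} f g = cong pickᵇ (lower-extensionality (lsuc ℓ) (lsuc ℓ) ext same)
      where
      same : ∀ i → truth Q i ≡ truth R i
      same i with em↓ {Q i} | em↓ {R i}
      ... | yes _ | yes _ = refl
      ... | yes q | no ¬r = ⊥-elim (¬r (f i q))
      ... | no ¬q | yes r = ⊥-elim (¬q (g i r))
      ... | no _  | no _  = refl

  module _ (x : V ℓ) where

    representative : Ix x → Ix x
    representative i = proj₁ (pick-complete {Q = λ j → el x i ≋ el x j} {i} ≋-refl)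

    representative-pick : ∀ i → pick (λ j → el x i ≋ el x j) ≡ just (representative i)
    representative-pick i = proj₂ (pick-complete {Q = λ j → el x i ≋ el x j} {i} ≋-refl)

    representative-≋ : ∀ i → el x i ≋ el x (representative i)
    representative-≋ i = pick-sound (representative-pick i)

    representative-cong : ∀ {i j} → el x i ≋ el x j → representative i ≡ representative j
    representative-cong {i} {j} e = just-injective (trans (sym (representative-pick i)) (trans
      (pick-cong (λ _ f → ≋-trans (≋-sym e) f) (λ _ f → ≋-trans e f)) (representative-pick j)))

    -- A copy without repetitions, in which equality of elements becomes identity of indices. Both
    -- the colouring argument and trichotomy on ω₁ speak of identical indices.
    normal : V ℓ
    normal = sup (Σ (Ix x) λ i → representative i ≡ i) (λ (i , _) → el x i)

    normal-≋ : normal ≋ x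
    normal-≋ = ≋-ext (λ (i , _) → ∊-el i)
      (λ i → ∊-intro (representative i , sym (representative-cong (representative-≋ i))) (representative-≋ i))

  Separated : V ℓ → Set ℓ
  Separated x = ∀ {i j} → el x i ≋ el x j → i ≡ j

  normal-separated : ∀ x → Separated (normal x)
  normal-separated x {i , f} {j , g} e = fixed (trans (sym f) (trans (representative-cong x e) g)) f g
    where
    fixed : ∀ {i j} → i ≡ j → (f : representative x i ≡ i) (g : representative x j ≡ j) → (i , f) ≡ (j , g)
    fixed refl f g = cong (_ ,_) (uip f g)

Countable : {ℓ : Level} → V ℓ → Set ℓ
Countable x = ∃ λ (e : Ix x → ℕ) → ∀ {i j} → e i ≡ e j → el x i ≋ el x j

Countable-resp : ∀ {ℓ} {x y : V ℓ} → x ≋ y → Countable x → Countable y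
Countable-resp {x = x} {y} p (e , h) = (λ j → e (proj₁ (index j))) , λ {i} {j} eq →
  ≋-trans (proj₂ (index i)) (≋-trans (h eq) (≋-sym (proj₂ (index j))))
  where
  index : ∀ j → ∃ λ i → el y j ≋ el x i
  index j = ∊-index (∊-respʳ (≋-sym p) (∊-el j))

Finite : {ℓ : Level} → V ℓ → Set ℓ
Finite x = ∃ λ k → Σ (Fin k → Ix x) λ s → ∀ i → ∃ λ m → el x i ≋ el x (s m)

image : ∀ {ℓ k} (x : V ℓ) → (Fin k → Ix x) → V ℓ
image {ℓ} {k} x s = sup (Lift ℓ (Fin k)) (λ m → el x (s (lower m)))

image-finite : ∀ {ℓ k} (x : V ℓ) (s : Fin k → Ix x) → Finite (image x s)
image-finite {k = k} x s = k , lift , λ m → lower m , ≋-refl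

module Cardinality {ℓ} (em : ExcludedMiddle (lsuc ℓ)) (ext : Extensionality (lsuc ℓ) (lsuc ℓ))
                   (P : Poset ℓ ℓ ℓ) where

  open Choice em ext
  open Names P
  open Functions P
  open Naturals em P

  private
    variable
      p q : Cond
      σ τ : Name

  -- Conditions of one colour form an antichain, hence are numbered by the ccc; the colour paired
  -- with that number is an injective code. Every application of the ccc passes through here. Equal
  -- codes give equivalent conditions, which are compatible, so the hypothesis applies once more.
  colouring : CCC → (T : Set ℓ) (c : T → Cond) (n : T → ℕ) →
              (∀ {s t} → n s ≡ n t → Compatible (c s) (c t) → s ≡ t) →
              ∃ λ (e : T → ℕ) → ∀ {s t} → e s ≡ e t → s ≡ t
  colouring ccc T c n h = (λ t → pair (n t) (code t refl)) , λ {s} {t} eq →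
    let n≡ , code≡ = pair-injective {n s} {_} {n t} eq in
    h n≡ (c s , ⊑-refl , ⊑-reflexive (proj₂ (ccc (Class (n t)) antichain)
      (trans (sym (code-irr n≡)) code≡)))
    where
    Class : ℕ → Cond → Set ℓ
    Class m p = Σ T λ t → n t ≡ m × c t ≡ p
    antichain : ∀ {m} → Antichain (Class m)
    antichain p q (s , refl , refl) (t , e , refl) p≉q comp with h (sym e) comp
    ... | refl = p≉q (Poset.Eq.refl P)
    -- The colour `m` is separate from `n t`, so that two elements of equal colour can be numbered
    -- within one and the same antichain.
    code : ∀ t {m} → n t ≡ m → ℕ
    code t {m} e = proj₁ (ccc (Class m) antichain) (c t , t , e , refl)
    code-irr : ∀ {s m} (e : n s ≡ m) → code s refl ≡ code s e
    code-irr refl = refl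

  -- The condition is strengthened once per index and earlier choices persist by monotonicity. This
  -- is how finiteness enters the preservation of (K1) and (K3).
  dense-Fin : ∀ {a b} {A : Set a} k {Φ : Fin k → A → Cond → Set b} →
              (∀ {m x p q} → Φ m x p → q ⊑ p → Φ m x q) →
              (∀ m → DenseBelow p (λ q → ∃ λ x → Φ m x q)) →
              DenseBelow p (λ q → ∃ λ (s : Fin k → A) → ∀ m → Φ m (s m) q)
  dense-Fin zero Φ-mono h = dense-all λ _ → (λ ()) , λ ()
  dense-Fin (suc k) Φ-mono h = dense-bind (h zero) λ q≤p (x , φ) →
    dense-map (dense-Fin k Φ-mono (λ m → dense-mono (h (suc m)) q≤p)) λ r≤q (s , f) →
      (λ { zero → x ; (suc m) → s m }) , λ { zero → Φ-mono φ r≤q ; (suc m) → f m }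

  maps-total : ∀ {f x y u} → p ⊨ isInjection f x y → p ⊨ u ∈̇ x → DenseBelow p (λ q → ∃ λ v → (q ⊨ v ∈̇ y) × (q ⊨ maps f u v))
  maps-total {f = f} {x} {y} {u} h u∈ = dense-map
    (∃∈E {σ = y} {Θ = λ v → maps f u v ∧̇ (∀̇[ v′ ] maps f u v′ ⇒̇ v′ ≐ v)} (∀∈E (∧E₂ (∧E₁ h)) u∈))
    λ _ (v , v∈ , k) → v , v∈ , ∧E₁ k

  maps-injective : ∀ {f x y u u′ v} → p ⊨ isInjection f x y → p ⊨ u ∈̇ x → p ⊨ u′ ∈̇ x →
                   p ⊨ maps f u v → p ⊨ maps f u′ v → p ⊨ u ≐ u′
  maps-injective {v = v} h u∈ u′∈ m m′ = ⇒E (∀E (∀∈E (∀∈E (∧E₂ h) u∈) u′∈) v) (∧I m m′)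

  ≼ω-value : ∀ {w f x u} → p ⊨ isω w → p ⊨ isInjection f x w → p ⊨ u ∈̇ x →
             DenseBelow p (λ q → ∃ λ n → q ⊨ maps f u (check (nat n)))
  ≼ω-value h inj u∈ = dense-bind (maps-total inj u∈) λ q≤p (v , v∈ , m) →
    dense-map (ω-member v (mono h q≤p) v∈) λ r≤q (n , e) → n , maps-resp ≐-refl e (mono m r≤q)

  ≼ω⇒countable : CCC → ∀ {x w f} → Separated x → p ⊨ isω w → p ⊨ isInjection f (check x) w → Countable x
  ≼ω⇒countable {p} ccc {x} {w} {f} sep isω inj =
    let e , e-inj = colouring ccc (Ix x) (λ i → proj₁ (value i)) (λ i → proj₁ (proj₂ (proj₂ (value i))))
                      (λ {i} {j} eq (a , a≤i , a≤j) → compatible eq a≤i a≤j)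
    in e , λ eq → ≡⇒≋ (cong (el x) (e-inj eq))
    where
    value : ∀ i → ∃ λ a → a ⊑ p × ∃ λ n → a ⊨ maps f (check (el x i)) (check (nat n))
    value i = dense-here (≼ω-value isω inj (∈-check-el i))
    compatible : ∀ {i j a} → proj₁ (proj₂ (proj₂ (value i))) ≡ proj₁ (proj₂ (proj₂ (value j))) →
                 a ⊑ proj₁ (value i) → a ⊑ proj₁ (value j) → i ≡ j
    compatible {i} {j} {a} eq a≤i a≤j =
      let _ , b≤p , n , m = value i ; _ , _ , n′ , m′ = value j in
      sep (check-≐⁻ (el x i) (el x j) (maps-injective (mono inj (⊑-trans a≤i b≤p)) (∈-check-el i) (∈-check-el j)
        (maps-resp ≐-refl (check-≐ (≡⇒≋ (cong nat eq))) (mono m a≤i)) (mono m′ a≤j)))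

  countable-separated : CCC → ∀ {x} → Separated x → p ⊨ countable (check x) → Countable x
  countable-separated ccc {x} sep h =
    let q , q≤p , w , k = dense-here (∃E {Θ = λ w → isω w ∧̇ check x ≼̇ w} h)
        r , r≤q , f , inj = dense-here (∃E {Θ = λ f → isInjection f (check x) w} (∧E₂ k))
    in ≼ω⇒countable ccc {x} sep (mono (∧E₁ k) r≤q) inj

  countable-check⁻ : CCC → ∀ {x} → p ⊨ countable (check x) → Countable x
  countable-check⁻ ccc {x} h = Countable-resp (normal-≋ x) (countable-separated ccc (normal-separated x)
    (resp₁ {σ = check x} {check (normal x)} countable (check-≐ (≋-sym (normal-≋ x))) h))

  countable-graph : ∀ {I : Set ℓ} {X : Name} (σ : I → Name) (R : Cond → I → ℕ → Set ℓ) →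
    (∀ {p q i n} → R p i n → q ⊑ p → R q i n) →
    (∀ {q i n} → q ⊑ p → R q i n → q ⊨ σ i ∈̇ X) →
    (∀ {q u} → q ⊑ p → q ⊨ u ∈̇ X → DenseBelow q (λ r → ∃ λ i → ∃ λ n → R r i n × (r ⊨ u ≐ σ i))) →
    (∀ {q i n i′ n′} → q ⊑ p → R q i n → R q i′ n′ → q ⊨ σ i ≐ σ i′ → n ≡ n′) →
    (∀ {q i i′ n} → q ⊑ p → R q i n → R q i′ n → q ⊨ σ i ≐ σ i′) →
    p ⊨ countable X
  countable-graph {I = I} σ R R-mono dom total fun inj = ∃I (check ω) (∧I ω-forced (∃I graph
    (graph-injection dom (λ {_} {_} {n} _ _ → check-∈ (nat∊ω (lower n)))
      (λ q≤p u∈ → dense-map (total q≤p u∈) λ _ (i , n , h) → i , lift n , h)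
      (λ q≤p r r′ e → check-≐ (≡⇒≋ (cong nat (fun q≤p r r′ e))))
      (λ {q} {i} {n} {i′} {n′} q≤p r r′ e → inj q≤p r (subst (R q i′) (sym (nat-injective (check-≐⁻ (nat (lower n)) (nat (lower n′)) e))) r′)))))
    where
    open Graph {I} {Lift ℓ ℕ} σ (λ n → check (nat (lower n))) (λ p i n → R p i (lower n)) R-mono

  check-countable : ∀ {x} → Countable x → p ⊨ countable (check x)
  check-countable {x = x} c = resp₁ {σ = check (normal x)} {check x} countable (check-≐ (normal-≋ x))
    (countable-graph {X = check (normal x)} (λ i → check (el (normal x) i)) (λ _ i n → Lift ℓ (e i ≡ n))
      (λ h _ → h) (λ {_} {i} _ _ → ∈-check-el {x = normal x} i)
      (λ _ u∈ → dense-map (∈-check⁻ u∈) λ _ (i , f) → i , e i , lift refl , f)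
      (λ { {i = i} {i′ = j} _ (lift refl) (lift refl) f → cong e (normal-separated x (check-≐⁻ (el (normal x) i) (el (normal x) j) f)) })
      (λ { _ (lift f) (lift g) → check-≐ (e-inj (trans f (sym g))) }))
    where
    e : Ix (normal x) → ℕ
    e = proj₁ (Countable-resp (≋-sym (normal-≋ x)) c)
    e-inj : ∀ {i j} → e i ≡ e j → el (normal x) i ≋ el (normal x) j
    e-inj = proj₂ (Countable-resp (≋-sym (normal-≋ x)) c)

  -- A bijection with a numeral requires a list without repetitions. The last clause drives the
  -- induction: retained entries come from the old tail, so a head missing there is still fresh.
  deduplicate : ∀ (x : V ℓ) k (s : Fin k → Ix x) → ∃ λ k′ → Σ (Fin k′ → Ix x) λ s′ →
    (∀ {m n} → el x (s′ m) ≋ el x (s′ n) → m ≡ n) × (∀ m → ∃ λ n → el x (s m) ≋ el x (s′ n)) × (∀ n → ∃ λ m → s′ n ≡ s m)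
  deduplicate x zero s = zero , s , (λ { {()} }) , (λ ()) , λ ()
  deduplicate x (suc k) s with deduplicate x k (λ m → s (suc m)) | em↓ {∃ λ m → el x (s zero) ≋ el x (s (suc m))}
  ... | k′ , s′ , inj , onto , from | yes (m , e) = k′ , s′ , inj
      , (λ { zero → let n , f = onto m in n , ≋-trans e f ; (suc m) → onto m })
      , λ n → let m , f = from n in suc m , f
  ... | k′ , s′ , inj , onto , from | no ¬e = suc k′ , s″ , inj″
      , (λ { zero → zero , ≋-refl ; (suc m) → let n , f = onto m in suc n , f })
      , λ { zero → zero , refl ; (suc n) → let m , f = from n in suc m , f }
    where
    s″ : Fin (suc k′) → Ix x
    s″ zero    = s zero
    s″ (suc n) = s′ n
    fresh : ∀ n → ¬ (el x (s zero) ≋ el x (s′ n))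
    fresh n e = let m , f = from n in ¬e (m , ≋-trans e (≡⇒≋ (cong (el x) f)))
    inj″ : ∀ {m n} → el x (s″ m) ≋ el x (s″ n) → m ≡ n
    inj″ {zero}  {zero}  e = refl
    inj″ {zero}  {suc n} e = ⊥-elim (fresh n e)
    inj″ {suc m} {zero}  e = ⊥-elim (fresh m (≋-sym e))
    inj″ {suc m} {suc n} e = cong suc (inj e)

  check-finite : ∀ {x} → Finite x → p ⊨ finite (check x)
  check-finite {x = x} (k , s , onto)
    with k′ , s′ , inj , onto′ , _ ← deduplicate x k s
    = ∃I (check ω) (∧I ω-forced (∃∈I (check (nat k′)) (check-∈ (nat∊ω k′)) (∃I graph
        (graph-bijection (λ _ _ → ∈-check-el _) (λ {_} {_} {n} _ _ → check-∈ (nat-mem (Fin.toℕ<n (lower n))))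
          (λ _ u∈ → dense-map (∈-check⁻ u∈) λ _ (i , e) →
             let m , f = onto i ; n , g = onto′ m in
             lift n , lift n , refl , ≐-trans e (check-≐ (≋-trans f g)))
          (λ { {i = i} {i′ = j} _ refl refl e → check-≐ (≡⇒≋ (cong (λ n → nat (toℕ n)) (inj (check-≐⁻ (el x (s′ (lower i))) (el x (s′ (lower j))) e)))) })
          (λ { {i = i} {i′ = j} _ refl refl e → check-≐ (≡⇒≋ (cong (λ n → el x (s′ n))
                (Fin.toℕ-injective (nat-injective (check-≐⁻ (nat (toℕ (lower i))) (nat (toℕ (lower j))) e))))) })
          (λ _ v∈ → dense-map (∈-check⁻ v∈) λ _ (j , e) →
             let m , lt , f = nat-mem⁻ k′ (∊-el j) in
             lift (fromℕ< lt) , lift (fromℕ< lt) , refl ,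
               ≐-trans e (check-≐ (≋-trans f (≡⇒≋ (cong nat (sym (Fin.toℕ-fromℕ< lt)))))))))))
    where
    open Graph {Lift ℓ (Fin k′)} {Lift ℓ (Fin k′)} (λ m → check (el x (s′ (lower m)))) (λ m → check (nat (toℕ (lower m))))
               (λ _ i j → i ≡ j) (λ h _ → h)

  -- First the size is decided, then the preimage of each numeral below it; the resulting list is a
  -- list in V. It is found only densely, as different conditions may choose different lists.
  finite-subset : ∀ {X y} → p ⊨ X ⊆̇ check y → p ⊨ finite X →
                  DenseBelow p (λ q → ∃ λ k → Σ (Fin k → Ix y) λ s → q ⊨ X ≐ check (image y s))
  finite-subset {X = X} {y} sub h =
    dense-bind (∃E {Θ = λ w → isω w ∧̇ (∃̇⟨ n ∈ w ⟩ X ≃̇ n)} h) λ q≤p (w , k) →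
    dense-bind (∃∈E {σ = w} {Θ = λ n → X ≃̇ n} (∧E₂ k)) λ r≤q (n , n∈ , eqv) →
    dense-bind (ω-member n (mono (∧E₁ k) r≤q) n∈) λ a≤r (m , e) →
    dense-bind (∃E {Θ = λ f → isBijection f X n} (mono eqv a≤r)) λ {b} b≤a (f , bij) →
    dense-map (enumerate (mono sub (⊑-trans b≤a (⊑-trans a≤r (⊑-trans r≤q q≤p))))
      (resp₃ {σ = f} {f} {X} {X} {n} {check (nat m)} isBijection ≐-refl ≐-refl (mono e b≤a) bij)) λ _ (s , g) → m , s , g
    where
    enumerate : ∀ {p f k} → p ⊨ X ⊆̇ check y → p ⊨ isBijection f X (check (nat k)) →
                DenseBelow p (λ q → ∃ λ (s : Fin k → Ix y) → q ⊨ X ≐ check (image y s))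
    enumerate {p} {f} {k} sub bij = dense-map
      (dense-Fin k {λ m i q → (q ⊨ check (el y i) ∈̇ X) × (q ⊨ maps f (check (el y i)) (check (nat (toℕ m))))}
        (λ (h , l) q≤p → mono h q≤p , mono l q≤p)
        (λ m → dense-bind (∃∈E {σ = X} {Θ = λ u → maps f u (check (nat (toℕ m)))} (∀∈E (∧E₂ bij) (check-∈ (nat-mem (Fin.toℕ<n m)))))
           λ q≤p (u , u∈ , l) → dense-map (∈-check⁻ (∀∈E (mono sub q≤p) u∈)) λ r≤q (i , e) →
             i , ∈-respˡ e (mono u∈ r≤q) , maps-resp e ≐-refl (mono l r≤q)))
      λ q≤p (s , g) → s , ⊆-antisym
        (∀∈I λ r≤q x x∈ → local (dense-bind (maps-total (mono (∧E₁ bij) (⊑-trans r≤q q≤p)) x∈) λ a≤r (v , v∈ , l) →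
          dense-map (∈-check⁻ v∈) λ b≤a (j , e) →
            let m , lt , e′ = nat-mem⁻ k (∊-el j)
                b≤r = ⊑-trans b≤a a≤r
                b≤q = ⊑-trans b≤r r≤q
                e″ = ≐-trans e (check-≐ (≋-trans e′ (≡⇒≋ (cong nat (sym (Fin.toℕ-fromℕ< lt))))))
                g₁ , g₂ = g (fromℕ< lt)
            in ∈-respˡ (≐-sym (maps-injective (mono (∧E₁ bij) (⊑-trans b≤q q≤p)) (mono x∈ b≤r) (mono g₁ b≤q)
                          (maps-resp ≐-refl e″ (mono l b≤a)) (mono g₂ b≤q)))
                 (∈-check-el {x = image y s} (lift (fromℕ< lt)))))
        (∀∈I λ r≤q x x∈ → local (dense-map (∈-check⁻ {x = image y s} x∈) λ a≤r (m , e) →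
          ∈-respˡ (≐-sym e) (mono (proj₁ (g (lower m))) (⊑-trans a≤r r≤q))))

  finite-check⁻ : ∀ {x} → p ⊨ finite (check x) → Finite x
  finite-check⁻ {x = x} h =
    let _ , _ , k , s , e = dense-here (finite-subset {y = x} (∀∈I λ _ _ z∈ → z∈) h)
        f = check-≐⁻ x (image x s) e
    in k , s , λ i → let m , g = ∊-index (∊-respʳ f (∊-el i)) in lower m , g

-- Forcing over a one-point poset is truth in V, so statements about V
-- are instances of statements about names.
module OnePoint (ℓ : Level) where

  𝟙 : Poset ℓ ℓ ℓ
  𝟙 = record
    { Carrier = Lift ℓ ⊤ ; _≈_ = λ _ _ → Lift ℓ ⊤ ; _≤_ = λ _ _ → Lift ℓ ⊤
    ; isPartialOrder = record
      { isPreorder = record { isEquivalence = record {} ; reflexive = λ _ → _ ; trans = λ _ _ → _ }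
      ; antisym = λ _ _ → _ } }

  open Names 𝟙

  𝟙-ccc : CCC
  𝟙-ccc A _ = (λ _ → 0) , λ _ → _

  value : Name → V ℓ
  value (name I σ _) = sup I (λ i → value (σ i))

  value-check : ∀ x → value (check x) ≋ x
  value-check (sup I x) = ≋-ext (λ (i , _) → ∊-intro i (value-check (x i)))
                                (λ i → ∊-intro (i , _) (≋-sym (value-check (x i))))

  mutual
    ≐⇒≋ : ∀ σ τ → _ ⊨ σ ≐ τ → value σ ≋ value τ
    ≐⇒≋ σ@(name I μ s) τ@(name J ν t) e = ≋-ext
      (λ i → ∈⇒∊ (μ i) τ (∈-respʳ e (∈-name i _)))
      (λ j → ∈⇒∊ (ν j) σ (∈-respʳ (≐-sym e) (∈-name j _)))

    ∈⇒∊ : ∀ σ τ → _ ⊨ σ ∈̇ τ → value σ ∊ value τ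
    ∈⇒∊ σ (name J ν t) h = let _ , _ , j , _ , e = dense-here (∈-name⁻ h) in ∊-intro j (≐⇒≋ σ (ν j) e)

  ≋⇒≐ : ∀ σ τ → value σ ≋ value τ → _ ⊨ σ ≐ τ
  ≋⇒≐ (name I μ s) (name J ν t) (mk≋ (f , g)) = ⊆-antisym
    (∀∈I λ _ x x∈ → local (dense-map (∈-name⁻ x∈) λ _ (i , _ , e) →
      let j , h = f i in ∈-respˡ (≐-sym (≐-trans e (≋⇒≐ (μ i) (ν j) (mk≋ h)))) (∈-name j _)))
    (∀∈I λ _ x x∈ → local (dense-map (∈-name⁻ x∈) λ _ (j , _ , e) →
      let i , h = g j in ∈-respˡ (≐-trans (≋⇒≐ (μ i) (ν j) (mk≋ h)) (≐-sym e)) (∈-name i _)))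

  ∊⇒∈ : ∀ σ τ → value σ ∊ value τ → _ ⊨ σ ∈̇ τ
  ∊⇒∈ σ (name J ν t) h = let j , e = ∊-index h in ∈-respˡ (≐-sym (≋⇒≐ σ (ν j) e)) (∈-name j _)

  mutual
    to-V : ∀ φ k {ρ ρ′} → (∀ j → value (ρ j) ≋ ρ′ j) → _ ⊨ eval k φ ρ → V⊨ eval k φ ρ′
    to-V (i ∈̇ j)  k e h = ∊↑ (∊-respˡ (e i) (∊-respʳ (e j) (∈⇒∊ _ _ h)))
    to-V (i ≐ j)  k e h = lift (un≋ (≋-trans (≋-sym (e i)) (≋-trans (≐⇒≋ _ _ h) (e j))))
    to-V (¬̇ φ)   k e h l = ¬E h (from-V φ k e l)
    to-V (φ ∧̇ ψ) k e h = to-V φ k e (∧E₁ h) , to-V ψ k e (∧E₂ h)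
    to-V (φ ∨̇ ψ) k e h with dense-here (∨E h)
    ... | _ , _ , inj₁ l = inj₁ (to-V φ k e l)
    ... | _ , _ , inj₂ l = inj₂ (to-V ψ k e l)
    to-V (φ ⇒̇ ψ) k e h l = to-V ψ k e (⇒E h (from-V φ k e l))
    to-V (all φ)  k e h x = to-V (φ k) (suc k) (update-rel (λ σ y → value σ ≋ y) k e (value-check x)) (∀E h (check x))
    to-V (ex φ)   k e h = let _ , _ , σ , l = dense-here (∃E h) in
      value σ , to-V (φ k) (suc k) (update-rel (λ σ y → value σ ≋ y) k e ≋-refl) l

    from-V : ∀ φ k {ρ ρ′} → (∀ j → value (ρ j) ≋ ρ′ j) → V⊨ eval k φ ρ′ → _ ⊨ eval k φ ρ
    from-V (i ∈̇ j)  k e h = ∊⇒∈ _ _ (∊-respˡ (≋-sym (e i)) (∊-respʳ (≋-sym (e j)) (∊↓ h)))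
    from-V (i ≐ j)  k e h = ≋⇒≐ _ _ (≋-trans (e i) (≋-trans (mk≋ (lower h)) (≋-sym (e j))))
    from-V (¬̇ φ)   k e h = ¬I λ _ l → h (to-V φ k e l)
    from-V (φ ∧̇ ψ) k e (h , l) = ∧I (from-V φ k e h) (from-V ψ k e l)
    from-V (φ ∨̇ ψ) k e (inj₁ h) = ∨I₁ (from-V φ k e h)
    from-V (φ ∨̇ ψ) k e (inj₂ h) = ∨I₂ (from-V ψ k e h)
    from-V (φ ⇒̇ ψ) k e h = ⇒I λ _ l → from-V ψ k e (h (to-V φ k e l))
    from-V (all φ)  k e h = ∀I λ σ → from-V (φ k) (suc k) (update-rel (λ σ y → value σ ≋ y) k e ≋-refl) (h (value σ))
    from-V (ex φ)   k e (x , h) =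
      ∃I (check x) (from-V (φ k) (suc k) (update-rel (λ σ y → value σ ≋ y) k e (value-check x)) h)

  -- A trip to names over `𝟙` and back: `from-V` may start at one representative and `to-V` end at
  -- another.
  V-resp : ∀ φ k {ρ ρ′} → (∀ j → ρ j ≋ ρ′ j) → V⊨ eval k φ ρ → V⊨ eval k φ ρ′
  V-resp φ k {ρ} e h = to-V φ k {λ j → check (ρ j)} (λ j → ≋-trans (value-check (ρ j)) (e j))
    (from-V φ k (λ j → value-check (ρ j)) h)

module Universe {ℓ} (em : ExcludedMiddle (lsuc ℓ)) (ext : Extensionality (lsuc ℓ) (lsuc ℓ)) where

  open OnePoint ℓ
  open Names 𝟙 using (mk⊨)
  open Cardinality em ext 𝟙 using (finite-check⁻; check-finite; countable-check⁻; check-countable)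

  finite⇒Finite : ∀ {x} → V⊨ finite x → Finite x
  finite⇒Finite {x} h = finite-check⁻ {x = x} (from-V (finite 0) 1 (λ _ → value-check x) h)

  Finite⇒finite : ∀ {x} → Finite x → V⊨ finite x
  Finite⇒finite {x} h = to-V (finite 0) 1 {ρ′ = env₁ x} (λ _ → value-check x) (check-finite h)

  countable⇒Countable : ∀ {x} → V⊨ countable x → Countable x
  countable⇒Countable {x} h = countable-check⁻ 𝟙-ccc {x = x} (from-V (countable 0) 1 (λ _ → value-check x) h)

  Countable⇒countable : ∀ {x} → Countable x → V⊨ countable x
  Countable⇒countable {x} h = to-V (countable 0) 1 {ρ′ = env₁ x} (λ _ → value-check x) (check-countable h)

-- The order of ω₁

-- Trichotomy is stated with `_≡_`, so this describes the index type of a set only once repetitions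
-- have been removed from it.
record IsOmega₁ {ℓ} (I : Set ℓ) (_≺_ : I → I → Set ℓ) : Set ℓ where
  field
    ≺-wf        : WellFounded _≺_
    ≺-trans     : ∀ {i j k} → i ≺ j → j ≺ k → i ≺ k
    ≺-compare   : ∀ i j → i ≺ j ⊎ i ≡ j ⊎ j ≺ i
    segment     : ∀ γ → ∃ λ (e : I → ℕ) → ∀ {i j} → i ≺ γ → j ≺ γ → e i ≡ e j → i ≡ j
    uncountable : ∀ (e : I → ℕ) → ¬ (∀ {i j} → e i ≡ e j → i ≡ j)

  _⪯_ : I → I → Set ℓ
  i ⪯ j = i ≺ j ⊎ i ≡ j

  ≺-irrefl : ∀ {i} → ¬ (i ≺ i)
  ≺-irrefl {i} = go (≺-wf i)
    where
    go : ∀ {i} → Acc _≺_ i → ¬ (i ≺ i)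
    go (acc rs) h = go (rs h) h

  ⊀⇒⪰ : ∀ {i j} → ¬ (i ≺ j) → j ⪯ i
  ⊀⇒⪰ {i} {j} h with ≺-compare i j
  ... | inj₁ lt        = ⊥-elim (h lt)
  ... | inj₂ (inj₁ eq) = inj₂ (sym eq)
  ... | inj₂ (inj₂ gt) = inj₁ gt

  ⪯-≺-trans : ∀ {i j k} → i ⪯ j → j ≺ k → i ≺ k
  ⪯-≺-trans (inj₁ lt) h = ≺-trans lt h
  ⪯-≺-trans (inj₂ refl) h = h

  ≺-⪯-trans : ∀ {i j k} → i ≺ j → j ⪯ k → i ≺ k
  ≺-⪯-trans h (inj₁ lt) = ≺-trans h lt
  ≺-⪯-trans h (inj₂ refl) = h

  maximum : ∀ {k} (s : Fin (suc k) → I) → ∃ λ m → ∀ n → s n ⪯ s m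
  maximum {zero} s = zero , λ { zero → inj₂ refl }
  maximum {suc k} s with maximum (λ n → s (suc n))
  ... | m , h with ≺-compare (s zero) (s (suc m))
  ...   | inj₁ lt = suc m , λ { zero → inj₁ lt ; (suc n) → h n }
  ...   | inj₂ (inj₁ eq) = suc m , λ { zero → inj₂ eq ; (suc n) → h n }
  ...   | inj₂ (inj₂ gt) = zero , λ { zero → inj₂ refl ; (suc n) → inj₁ (⪯-≺-trans (h n) gt) }

module Omega₁ {ℓ} (em : ExcludedMiddle (lsuc ℓ)) (ext : Extensionality (lsuc ℓ) (lsuc ℓ))
              {I : Set ℓ} {_≺_ : I → I → Set ℓ} (isOmega₁ : IsOmega₁ I _≺_) where

  open IsOmega₁ isOmega₁
  open Choice em ext using (em↓)

  closed-segment : ∀ γ → ∃ λ (e : I → ℕ) → ∀ {i j} → i ⪯ γ → j ⪯ γ → e i ≡ e j → i ≡ j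
  closed-segment γ = code , code-inj
    where
    e : I → ℕ
    e = proj₁ (segment γ)
    code : I → ℕ
    code i with em↓ {i ≡ γ}
    -- 0 is reserved for `γ` itself; the codes of the strict segment are shifted by one.
    ... | yes _ = 0
    ... | no _  = suc (e i)
    strict : ∀ {i} → i ⪯ γ → ¬ (i ≡ γ) → i ≺ γ
    strict (inj₁ lt) _ = lt
    strict (inj₂ eq) h = ⊥-elim (h eq)
    code-inj : ∀ {i j} → i ⪯ γ → j ⪯ γ → code i ≡ code j → i ≡ j
    code-inj {i} {j} h k eq with em↓ {i ≡ γ} | em↓ {j ≡ γ}
    ... | yes p | yes q = trans p (sym q)
    ... | no ¬p | no ¬q = proj₂ (segment γ) (strict h ¬p) (strict k ¬q) (ℕ.suc-injective eq)

  -- If u is unbounded, choosing v i with i ⪯ u (v i) embeds I into countably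
  -- many countable segments.
  bounded : ∀ {T : Set ℓ} (u : T → I) (e : T → ℕ) → (∀ {s t} → e s ≡ e t → u s ≡ u t) → ∃ λ γ → ∀ t → u t ≺ γ
  bounded {T} u e e-inj with em↓ {∃ λ γ → ∀ t → u t ≺ γ}
  ... | yes h = h
  ... | no ¬h = ⊥-elim (uncountable (λ i → pair (e (v i)) (code (u (v i)) i)) λ {i} {j} eq →
          let e≡ , c≡ = pair-injective {e (v i)} {code (u (v i)) i} {e (v j)} eq in
          same (e-inj e≡) (v-above i) (v-above j) c≡)
    where
    unbounded : ∀ i → ∃ λ t → i ⪯ u t
    unbounded i with em↓ {∃ λ t → i ⪯ u t}
    ... | yes k = k
    ... | no ¬k = ⊥-elim (¬h (i , λ t → [ (λ lt → lt) , (λ eq → ⊥-elim (¬k (t , inj₂ (sym eq)))) ]′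
                    (⊀⇒⪰ λ lt → ¬k (t , inj₁ lt))))
    v : I → T
    v i = proj₁ (unbounded i)
    v-above : ∀ i → i ⪯ u (v i)
    v-above i = proj₂ (unbounded i)
    code : I → I → ℕ
    code γ = proj₁ (closed-segment γ)
    same : ∀ {γ δ i j} → γ ≡ δ → i ⪯ γ → j ⪯ δ → code γ i ≡ code δ j → i ≡ j
    same refl h k eq = proj₂ (closed-segment _) h k eq

  -- Otherwise all values lie in the closed segment of `γ`, which is countable.
  injective⇒unbounded : (t : I → I) → (∀ {i j} → t i ≡ t j → i ≡ j) → ∀ γ → ∃ λ i → γ ≺ t i
  injective⇒unbounded t t-inj γ with em↓ {∃ λ i → γ ≺ t i}
  ... | yes h = h
  ... | no ¬h = ⊥-elim (uncountable (λ i → proj₁ (closed-segment γ) (t i)) λ {i} {j} eq →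
          t-inj (proj₂ (closed-segment γ) (⊀⇒⪰ (λ lt → ¬h (i , lt))) (⊀⇒⪰ (λ lt → ¬h (j , lt))) eq))

  module _ (h : I → I) where

    private
      -- A Boolean makes the proof component unique. Proofs of `i ≺ j` may differ, while `bounded`
      -- needs a value determined by the index alone.
      Before : I → Set ℓ
      Before j = Σ I λ i → T (does (em↓ {i ≺ j}))

      earlier : ∀ {i j} → T (does (em↓ {i ≺ j})) → i ≺ j
      earlier {i} {j} h with em↓ {i ≺ j}
      ... | yes lt = lt

      before : ∀ {i j} → i ≺ j → T (does (em↓ {i ≺ j}))
      before {i} {j} lt with em↓ {i ≺ j}
      ... | yes _ = tt
      ... | no ¬lt = ¬lt lt

      Before-≡ : ∀ {j} {s t : Before j} → proj₁ s ≡ proj₁ t → s ≡ t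
      Before-≡ {s = i , b} {_ , c} refl = cong (i ,_) (T-irrelevant b c)

      bound : ∀ j (prev : ∀ {i} → i ≺ j → I) → ∃ λ γ → ∀ (t : Before j) → h (prev (earlier (proj₂ t))) ≺ γ
      bound j prev = bounded (λ (t : Before j) → h (prev (earlier (proj₂ t)))) (λ t → proj₁ (segment j) (proj₁ t))
        λ {s} {t} eq → cong (λ (t : Before j) → h (prev (earlier (proj₂ t))))
          (Before-≡ (proj₂ (segment j) (earlier (proj₂ s)) (earlier (proj₂ t)) eq))

      next : ∀ j → (∀ {i} → i ≺ j → I) → I
      next j prev = proj₁ (bound j prev)

      ext↓ : Extensionality ℓ ℓ
      ext↓ = lower-extensionality (lsuc ℓ) (lsuc ℓ) ext

      -- The unfolding equation of well-founded recursion asks that a step depend only on the values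
      -- of `prev`; extensionality grants this for the chosen bound.
      next-cong : ∀ j {prev prev′ : ∀ {i} → i ≺ j → I} → (∀ {i} (lt : i ≺ j) → prev lt ≡ prev′ lt) →
                  next j prev ≡ next j prev′
      next-cong j eq = cong (λ (prev : ∀ {i} → i ≺ j → I) → next j prev) (implicit-extensionality ext↓ (ext↓ eq))

      open FixPoint ≺-wf (λ _ → I) next next-cong using (unfold-wfRec)

      G : I → I
      G = All.wfRec ≺-wf ℓ (λ _ → I) next

    sparse : ∃ λ (g : I → I) → ∀ {i j} → i ≺ j → h (g i) ≺ g j
    sparse = G , λ {i} {j} lt → subst (h (G i) ≺_) (sym (unfold-wfRec {j})) (proj₂ (bound j (λ {k} _ → G k)) (i , before lt))

module Omega₁Index {ℓ} (em : ExcludedMiddle (lsuc ℓ)) (ext : Extensionality (lsuc ℓ) (lsuc ℓ)) where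

  open Choice em ext
  open Universe em ext

  ordinal-member : ∀ {x y : V ℓ} → V⊨ ordinal x → y ∊ x → V⊨ ordinal y
  ordinal-member {x} {y} (tr , trs) y∈ = trs y (∊↑ y∈) , λ z z∈ → trs z (tr y (∊↑ y∈) z z∈)

  -- If neither set equals, or lies in, an element of the other, the remaining alternative puts all
  -- elements of each into the other, and extensionality applies.
  compare-step : ∀ {x y : V ℓ} → V⊨ ordinal x → V⊨ ordinal y →
                 (∀ i → el x i ∊ y ⊎ el x i ≋ y ⊎ y ∊ el x i) → (∀ j → x ∊ el y j ⊎ x ≋ el y j ⊎ el y j ∊ x) →
                 x ∊ y ⊎ x ≋ y ⊎ y ∊ x
  compare-step {x} {y} ox oy left right with em↓ {∃ λ i → y ≋ el x i ⊎ y ∊ el x i}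
  ... | yes (i , inj₁ e) = inj₂ (inj₂ (∊-intro i e))
  ... | yes (i , inj₂ h) = inj₂ (inj₂ (∊↓ (proj₁ ox (el x i) (∊↑ (∊-el i)) y (∊↑ h))))
  ... | no ¬i with em↓ {∃ λ j → x ≋ el y j ⊎ x ∊ el y j}
  ...   | yes (j , inj₁ e) = inj₁ (∊-intro j e)
  ...   | yes (j , inj₂ h) = inj₁ (∊↓ (proj₁ oy (el y j) (∊↑ (∊-el j)) x (∊↑ h)))
  ...   | no ¬j = inj₂ (inj₁ (≋-ext
      (λ i → [ (λ h → h) , (λ h → ⊥-elim (¬i (i , [ (λ e → inj₁ (≋-sym e)) , inj₂ ]′ h))) ]′ (left i))
      (λ j → [ (λ h → ⊥-elim (¬j (j , inj₂ h))) , [ (λ e → ⊥-elim (¬j (j , inj₁ e))) , (λ h → h) ]′ ]′ (right j))))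

  ∊-compare : ∀ x y → V⊨ ordinal x → V⊨ ordinal y → x ∊ y ⊎ x ≋ y ⊎ y ∊ x
  ∊-compare (sup I f) (sup J g) ox oy = compare-step ox oy
    (λ i → ∊-compare (f i) (sup J g) (ordinal-member {sup I f} ox (∊-el i)) oy)
    (λ j → ∊-compare (sup I f) (g j) ox (ordinal-member {sup J g} oy (∊-el j)))

  segment-code : ∀ {w x} → Separated w → Countable x →
                 ∃ λ (e : Ix w → ℕ) → ∀ {i j} → el w i ∊ x → el w j ∊ x → e i ≡ e j → i ≡ j
  segment-code {w} {x} sep (e , e-inj) = code , code-inj
    where
    code : Ix w → ℕ
    code i with em↓ {el w i ∊ x}
    ... | yes h = e (proj₁ (∊-index h))
    ... | no _  = 0
    code-inj : ∀ {i j} → el w i ∊ x → el w j ∊ x → code i ≡ code j → i ≡ j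
    code-inj {i} {j} h k eq with em↓ {el w i ∊ x} | em↓ {el w j ∊ x}
    ... | yes h′ | yes k′ = sep (≋-trans (proj₂ (∊-index h′)) (≋-trans (e-inj eq) (≋-sym (proj₂ (∊-index k′)))))
    ... | yes _ | no ¬k = ⊥-elim (¬k k)
    ... | no ¬h | _ = ⊥-elim (¬h h)

  isOmega₁ : ∀ {w} → Separated w → V⊨ isω₁ w → IsOmega₁ (Ix w) (λ i j → el w i ∊ el w j)
  isOmega₁ {w} sep (ord , unc , cbl) = record
    { ≺-wf = On.wellFounded (el w) ∊-wf
    ; ≺-trans = λ {i} {j} {k} h l → ∊↓ (proj₂ ord (el w k) (∊↑ (∊-el k)) (el w j) (∊↑ l) (el w i) (∊↑ h))
    ; ≺-compare = λ i j → [ inj₁ , [ (λ e → inj₂ (inj₁ (sep e))) , (λ h → inj₂ (inj₂ h)) ]′ ]′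
        (∊-compare (el w i) (el w j) (ordinal-member {w} ord (∊-el i)) (ordinal-member {w} ord (∊-el j)))
    ; segment = λ γ → segment-code {w} {el w γ} sep (countable⇒Countable (cbl (el w γ) (∊↑ (∊-el γ))))
    ; uncountable = λ e e-inj → unc (Countable⇒countable (e , λ eq → ≡⇒≋ (cong (el w) (e-inj eq))))
    }

-- Preservation of (K1) and (K3)

-- Truth in V lives in `Set (lsuc ℓ)`; deciding it into a Boolean brings the index type back to
-- `Set ℓ`.
separate : ∀ {ℓ} → ExcludedMiddle (lsuc ℓ) → V ℓ → (V ℓ → Set (lsuc ℓ)) → V ℓ
separate em x Q = sup (Σ (Ix x) λ i → T (does (em {Q (el x i)}))) (λ (i , _) → el x i)

module _ {ℓ} (em : ExcludedMiddle (lsuc ℓ)) {Q : V ℓ → Set (lsuc ℓ)} (Q-resp : ∀ {x y} → x ≋ y → Q x → Q y) where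

  separate-∊ : ∀ {x y} → y ∊ x → Q y → y ∊ separate em x Q
  separate-∊ {x} h q = let i , e = ∊-index h in ∊-intro (i , yes-does (Q-resp e q)) e
    where
    yes-does : ∀ {A : Set (lsuc ℓ)} → A → T (does (em {A}))
    yes-does {A} a with em {A}
    ... | yes _ = tt
    ... | no ¬a = ¬a a

  separate-∊⁻ : ∀ {x y} → y ∊ separate em x Q → (y ∊ x) × Q y
  separate-∊⁻ {x} h = let (i , t) , e = ∊-index h in ∊-intro i e , Q-resp (≋-sym e) (does-yes t)
    where
    does-yes : ∀ {A : Set (lsuc ℓ)} → T (does (em {A})) → A
    does-yes {A} t with em {A}
    ... | yes a = a

module Preservation {ℓ} (em : ExcludedMiddle (lsuc ℓ)) (ext : Extensionality (lsuc ℓ) (lsuc ℓ))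
                    (P : Poset ℓ ℓ ℓ) where

  open Choice em ext
  open Universe em ext
  open OnePoint ℓ using (V-resp)
  open Names P
  open Naturals em P
  open Cardinality em ext P

  private
    variable
      p q : Cond
      σ τ : Name

  -- Every member of a check name is densely equal to a check name, and `resp₂` transports the
  -- formula along that equality.
  ∀∈-check : ∀ (φ : ℕ → ℕ → Formula ℕ) c A → (∀ i → p ⊨ eval 2 (φ 0 1) (env₂ c (check (el A i)))) →
             p ⊨ all∈ (check A) (λ x → eval 2 (φ 0 1) (env₂ c x))
  ∀∈-check φ c A h = ∀∈I λ q≤p x x∈ → local (dense-map (∈-check⁻ x∈) λ r≤q (i , e) →
    resp₂ {σ = c} {c} {check (el A i)} {x} φ ≐-refl (≐-sym e) (mono (h i) (⊑-trans r≤q q≤p)))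

  check-⊆ : ∀ {x y} → V⊨ x ⊆̇ y → p ⊨ check x ⊆̇ check y
  check-⊆ {x = x} {y} h = ∀∈-check (λ y z → z ∈̇ y) (check y) x (λ i → check-∈ (∊↓ (h _ (∊↑ (∊-el i)))))

  check-⊆⁻ : ∀ {x y} → p ⊨ check x ⊆̇ check y → V⊨ x ⊆̇ y
  check-⊆⁻ h z z∈ = ∊↑ (check-∈⁻ (∀∈E h (check-∈ (∊↓ z∈))))

  check-finiteSubset : ∀ {x y} → V⊨ finiteSubset x y → p ⊨ finiteSubset (check x) (check y)
  check-finiteSubset {x = x} {y} h = ∧I (check-⊆ {x = x} {y} (proj₁ h)) (check-finite (finite⇒Finite (proj₂ h)))

  check-finiteSubset⁻ : ∀ {x y} → p ⊨ finiteSubset (check x) (check y) → V⊨ finiteSubset x y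
  check-finiteSubset⁻ h = check-⊆⁻ (∧E₁ h) , Finite⇒finite (finite-check⁻ (∧E₂ h))

  image-finiteSubset : ∀ {k} y (s : Fin k → Ix y) → V⊨ finiteSubset (image y s) y
  image-finiteSubset y s =
    (λ z z∈ → let m , e = ∊-index (∊↓ z∈) in ∊↑ (∊-intro (s (lower m)) e)) , Finite⇒finite (image-finite y s)

  check-isω₁ : CCC → ∀ {w} → V⊨ isω₁ w → p ⊨ isω₁ (check w)
  check-isω₁ ccc {w} h = ∧I (absolute↑ {ρ = env₁ w} ordinal↑ (λ _ → ≐-refl) (proj₁ h)) (∧I
    (¬I λ _ c → proj₁ (proj₂ h) (Countable⇒countable (countable-check⁻ ccc {w} c)))
    (∀∈-check (λ _ → countable) (check w) w
      (λ i → check-countable (countable⇒Countable (proj₂ (proj₂ h) (el w i) (∊↑ (∊-el i)))))))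

  check-familiesOn : ∀ {w F} → V⊨ familiesOn w F → p ⊨ familiesOn (check w) (check F)
  check-familiesOn {w = w} {F} h = ∀∈-check
    (λ w A → (∀̇⟨ x ∈ A ⟩ finiteSubset x w ∧̇ nonempty x) ∧̇ nonOverlapping A) (check w) F
    (λ i → ∧I
      (∀∈-check (λ w x → finiteSubset x w ∧̇ nonempty x) (check w) (el F i)
        (λ j → let f , x , x∈ = proj₁ (h (el F i) (∊↑ (∊-el i))) (el (el F i) j) (∊↑ (∊-el j)) in
          ∧I (check-finiteSubset f) (∃I (check x) (check-∈ (∊↓ x∈)))))
      (absolute↑ {ρ = env₁ (el F i)} nonOverlapping↑ (λ _ → ≐-refl) (proj₂ (h (el F i) (∊↑ (∊-el i))))))
    where
    max<min↑ : ∀ {k x y} → (x ≡ᵇ k) ≡ false → (x ≡ᵇ suc (suc k)) ≡ false → (y ≡ᵇ suc (suc k)) ≡ false → Pol up k (x max<min y)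
    max<min↑ _ x≢ y≢ = ∃↑ (∃↑ (and (and mem (∀∈ refl x≢ (or mem equ))) (and (and mem (∀∈ refl y≢ (or mem equ))) mem)))
    nonOverlapping↑ : Pol up 1 (nonOverlapping 0)
    nonOverlapping↑ = ∀∈ refl refl (∀∈ refl refl (imp (neg equ) (or (max<min↑ refl refl refl) (max<min↑ refl refl refl))))

  -- `finite` quantifies over all functions of the extension, and `Pol` has no downward rule for
  -- that. Both transfers of finiteness are therefore invoked explicitly, the converse one for
  -- members of `A` that become finite subsets of `α` only in the extension's sense.
  check-isTrace : ∀ {B A α} → V⊨ isTrace B A α → p ⊨ isTrace (check B) (check A) (check α)
  check-isTrace {B = B} {A} {α} h = ∀I λ x → ∧I
    (⇒I λ _ x∈ → local (dense-map (∈-check⁻ x∈) λ {r} _ (i , e) →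
      let a , f = proj₁ (h (el B i)) (∊↑ (∊-el i)) in
      resp₃ {r} {check A} {check A} {check α} {check α} {check (el B i)} {x} (λ A α x → x ∈̇ A ∧̇ finiteSubset x α)
        ≐-refl ≐-refl (≐-sym e) (∧I (check-∈ (∊↓ a)) (check-finiteSubset f))))
    (⇒I λ _ x∈ → local (dense-map (∈-check⁻ (∧E₁ x∈)) λ {r} r≤q (i , e) →
      let f = resp₂ {r} {x} {check (el A i)} {check α} {check α} finiteSubset e ≐-refl (mono (∧E₂ x∈) r≤q) in
      ∈-respˡ (≐-sym e) (check-∈ (∊↓ (proj₂ (h (el A i)) (∊↑ (∊-el i) , check-finiteSubset⁻ f))))))

  trace-unique : ∀ {B B′ A α} → p ⊨ isTrace B A α → p ⊨ isTrace B′ A α → p ⊨ B ≐ B′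
  trace-unique {p} {B} {B′} {A} {α} h h′ = ⊆-antisym (sub h h′) (sub h′ h)
    where
    sub : ∀ {B B′} → p ⊨ isTrace B A α → p ⊨ isTrace B′ A α → p ⊨ B ⊆̇ B′
    sub h h′ = ∀∈I λ q≤p x x∈ → ⇒E (∧E₂ (∀E (mono h′ q≤p) x)) (⇒E (∧E₁ (∀E (mono h q≤p) x)) x∈)

  trace : V ℓ → V ℓ → V ℓ
  trace A α = separate em A (λ x → V⊨ finiteSubset x α)

  trace-isTrace : ∀ A α → V⊨ isTrace (trace A α) A α
  trace-isTrace A α x =
      (λ h → let a , f = separate-∊⁻ em resp (∊↓ h) in ∊↑ a , f)
    , (λ (a , f) → ∊↑ (separate-∊ em resp (∊↓ a) f))
    where
    resp : ∀ {x y} → x ≋ y → V⊨ finiteSubset x α → V⊨ finiteSubset y α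
    resp {x} {y} e = V-resp (finiteSubset 0 1) 2 {env₂ x α} {env₂ y α} λ { zero → e ; (suc _) → ≋-refl }

  check-isRestriction : ∀ {R F α} → V⊨ isRestriction R F α → p ⊨ isRestriction (check R) (check F) (check α)
  check-isRestriction {R = R} {F} {α} h = ∀I λ B → ∧I
    (⇒I λ _ B∈ → local (dense-map (∈-check⁻ B∈) λ {r} _ (i , e) →
      let A , A∈ , t = proj₁ (h (el R i)) (∊↑ (∊-el i)) in
      ∃∈I (check A) (check-∈ (∊↓ A∈))
        (resp₃ {r} {check (el R i)} {B} {check A} {check A} {check α} {check α} isTrace (≐-sym e) ≐-refl ≐-refl
          (check-isTrace {B = el R i} {A} {α} t))))
    -- No new traces appear: `A` is densely a family of V, its trace is formed there, and
    -- `trace-unique` identifies `B` with it.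
    (⇒I λ _ k → local (dense-bind (∃∈E {σ = check F} {Θ = λ A → isTrace B A (check α)} k) λ _ (A , A∈ , t) →
      dense-map (∈-check⁻ A∈) λ {r} r≤q (i , e) →
        let B₀ = trace (el F i) α
            t₀ = trace-isTrace (el F i) α
            t′ = resp₃ {r} {B} {B} {A} {check (el F i)} {check α} {check α} isTrace ≐-refl e ≐-refl (mono t r≤q)
        in ∈-respˡ (trace-unique {B = check B₀} {B} {check (el F i)} {check α} (check-isTrace {B = B₀} {el F i} {α} t₀) t′)
             (check-∈ (∊↓ (proj₂ (h B₀) (el F i , ∊↑ (∊-el i) , t₀))))))

  check-K1 : ∀ {w F} → V⊨ K1 w F → p ⊨ K1 (check w) (check F)
  check-K1 {w = w} {F} h = ∀∈-check (λ F α → ∃̇[ R ] isRestriction R F α ∧̇ countable R) (check F) w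
    (λ i → let R , r , c = h (el w i) (∊↑ (∊-el i)) in
      ∃I (check R) (∧I (check-isRestriction {R = R} {F} {el w i} r) (check-countable (countable⇒Countable c))))

  -- Below a condition deciding the part of d inside the finite set c, that part
  -- is a closed set of V, so it is all of c.
  check-isClosure : ∀ {w c x F} → V⊨ isClosure w c x F → Finite c → p ⊨ isClosure (check w) (check c) (check x) (check F)
  check-isClosure {p} {w} {c} {x} {F} (closed , least) (k , s , onto) = ∧I
    (absolute↑ {ρ = env₄ w c x F} {env₄ (check w) (check c) (check x) (check F)} closedOver↑
      (λ { zero → ≐-refl ; (suc zero) → ≐-refl ; (suc (suc zero)) → ≐-refl ; (suc (suc (suc _))) → ≐-refl }) closed)
    (∀I λ d → ⇒I λ _ h → local (dense-map
      (dense-Fin k {λ m (_ : ⊤) r → (r ⊨ check (el c (s m)) ∈̇ d) ⊎ (r ⊨ ¬̇ (check (el c (s m)) ∈̇ d))}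
        (λ { (inj₁ k) q≤p → inj₁ (mono k q≤p) ; (inj₂ k) q≤p → inj₂ (mono k q≤p) })
        (λ m → dense-map (by-cases (check (el c (s m)) ∈̇ d)) λ _ k → tt , k))
      λ r≤q (_ , decided) → contains (mono h r≤q) decided))
    where
    closedOver↑ : Pol up 4 (isClosedOver 0 1 2 3)
    closedOver↑ = and (∀∈ refl refl mem) (and (∀∈ refl refl mem)
      (∀∈ refl refl (∀∈ refl refl (or (neg (∃∈ refl refl mem)) (∀∈ refl refl mem)))))

    module _ {r d} (h : r ⊨ isClosedOver (check w) d (check x) (check F))
             (decided : ∀ m → (r ⊨ check (el c (s m)) ∈̇ d) ⊎ (r ⊨ ¬̇ (check (el c (s m)) ∈̇ d))) where

      -- A set of V because `_⊩_∈ⁿ_` takes values in `Set ℓ`.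
      e : V ℓ
      e = sup (Σ (Ix c) λ i → r ⊩ check (el c i) ∈ⁿ d) (λ (i , _) → el c i)

      -- `r` has decided every element of `c`, so it cannot deny a membership that a stronger `q`
      -- forces.
      e-intro : ∀ {z q} → z ∊ c → q ⊑ r → q ⊨ check z ∈̇ d → z ∊ e
      e-intro {z} {q} z∈ q≤r k with ∊-index z∈
      ... | i , f with onto i
      ...   | m , g with decided m
      ...     | inj₂ l = ⊥-elim (¬E (mono l q≤r) (∈-respˡ (check-≐ (≋-trans f g)) k))
      ...     | inj₁ l = ∊-intro (i , lower (un⊨ (∈-respˡ (≐-sym (check-≐ g)) l))) f

      e-elim : ∀ {z} → z ∊ e → (z ∊ c) × (r ⊨ check z ∈̇ d)
      e-elim z∈ = let (i , k) , f = ∊-index z∈ in ∊-intro i f , ∈-respˡ (≐-sym (check-≐ f)) (mk⊨ (lift k))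

      -- When `b` lies inside `c`, some `q` below `r` decides whether `d` misses or contains `b`; as
      -- `r` has decided `c`, that answer holds of `e`.
      absorbs : ∀ {b A} → A ∊ F → b ∊ A → V⊨ disjoint b c ∨̇ b ⊆̇ c → V⊨ disjoint b e ∨̇ b ⊆̇ e
      absorbs A∈ b∈ (inj₁ dis) = inj₁ λ (z , z∈b , z∈e) → dis (z , z∈b , ∊↑ (proj₁ (e-elim (∊↓ z∈e))))
      absorbs {b} A∈ b∈ (inj₂ sub) =
        [ (λ dis → inj₁ λ (z , z∈b , z∈e) → ¬E dis
             (∃I (check z) (∧I (check-∈ (∊↓ z∈b)) (mono (proj₂ (e-elim (∊↓ z∈e))) q≤r))))
        , (λ sub′ → inj₂ λ z z∈b → ∊↑ (e-intro (∊↓ (sub z z∈b)) q≤r (∀∈E sub′ (check-∈ (∊↓ z∈b)))))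
        ]′ (proj₂ (proj₂ here))
        where
        here : ∃ λ q → q ⊑ r × ((q ⊨ disjoint (check b) d) ⊎ (q ⊨ check b ⊆̇ d))
        here = dense-here (∨E (∀∈E (∀∈E (∧E₂ (∧E₂ h)) (check-∈ A∈)) (check-∈ b∈)))
        q≤r : proj₁ here ⊑ r
        q≤r = proj₁ (proj₂ here)

      e-closed : V⊨ isClosedOver w e x F
      e-closed = (λ z z∈ → proj₁ closed z (∊↑ (proj₁ (e-elim (∊↓ z∈)))))
        , (λ z z∈ → ∊↑ (e-intro (∊↓ (proj₁ (proj₂ closed) z z∈)) ⊑-refl (∀∈E (∧E₁ (∧E₂ h)) (check-∈ (∊↓ z∈)))))
        , (λ A A∈ b b∈ → absorbs (∊↓ A∈) (∊↓ b∈) (proj₂ (proj₂ closed) A A∈ b b∈))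

      contains : r ⊨ check c ⊆̇ d
      contains = ∀∈-check (λ d z → z ∈̇ d) d c (λ i → proj₂ (e-elim (∊↓ (least e e-closed (el c i) (∊↑ (∊-el i))))))

  check-K3 : ∀ {w F} → V⊨ K3 w F → p ⊨ K3 (check w) (check F)
  check-K3 {w = w} {F} h = ∀I λ x → ⇒I λ _ hx → ∀I λ F′ → ⇒I λ r≤q hF → ∃I-dense
    (dense-bind (finite-subset {y = w} (∧E₁ (mono hx r≤q)) (∧E₂ (mono hx r≤q))) λ a≤r (_ , s , e) →
     dense-map (finite-subset {y = F} (∧E₁ (mono hF a≤r)) (∧E₂ (mono hF a≤r))) λ {b} b≤a (_ , t , f) →
       closure s t (mono e b≤a) f)
    where
    closure : ∀ {b x F′ k l} (s : Fin k → Ix w) (t : Fin l → Ix F) →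
              b ⊨ x ≐ check (image w s) → b ⊨ F′ ≐ check (image F t) → ∃ λ c → b ⊨ isClosure (check w) c x F′ ∧̇ finite c
    closure {b} {x} {F′} s t e f = check (proj₁ c) , ∧I
      (resp₄ {b} {check w} {check w} {check (proj₁ c)} {check (proj₁ c)} {check (image w s)} {x} {check (image F t)} {F′} isClosure
        ≐-refl ≐-refl (≐-sym e) (≐-sym f) (check-isClosure {w = w} {proj₁ c} {image w s} {image F t} (proj₁ (proj₂ c)) c-finite))
      (check-finite c-finite)
      where
      c : ∃ λ c → V⊨ isClosure w c (image w s) (image F t) ∧̇ finite c
      c = h (image w s) (image-finiteSubset w s) (image F t) (image-finiteSubset F t)
      c-finite : Finite (proj₁ c)
      c-finite = finite⇒Finite (proj₂ (proj₂ c))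

-- Preservation of (K2)

module Uncountable {ℓ} (em : ExcludedMiddle (lsuc ℓ)) (ext : Extensionality (lsuc ℓ) (lsuc ℓ))
  (P : Poset ℓ ℓ ℓ) {w : V ℓ} (sep : Choice.Separated em ext w)
  (w-transitive : ∀ {x y} → x ∊ y → y ∊ w → x ∊ w) (isOmega : IsOmega₁ (Ix w) (λ i j → el w i ∊ el w j)) where

  open Choice em ext
  open Names P
  open Functions P
  open Naturals em P
  open Cardinality em ext P
  open IsOmega₁ isOmega
  open Omega₁ em ext isOmega

  I : Set ℓ
  I = Ix w

  infix 4 _≺_
  _≺_ : I → I → Set ℓ
  i ≺ j = el w i ∊ el w j

  by-contradiction : ∀ {A : Set (lsuc ℓ)} → ¬ ¬ A → A
  by-contradiction {A} h with em {A}
  ... | yes a = a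
  ... | no ¬a = ⊥-elim (h ¬a)

  least : (N : I → Set (lsuc ℓ)) → ∀ {i} → N i → ∃ λ a → N a × a ⪯ i × (∀ {c} → c ≺ a → ¬ N c)
  least N {i} = go (≺-wf i)
    where
    go : ∀ {i} → Acc _≺_ i → N i → ∃ λ a → N a × a ⪯ i × (∀ {c} → c ≺ a → ¬ N c)
    go {i} (acc rs) n with em {∃ λ c → c ≺ i × N c}
    ... | yes (c , lt , m) = let a , na , le , f = go (rs lt) m in a , na , inj₁ (⪯-≺-trans le lt) , f
    ... | no ¬c = i , n , inj₂ refl , λ lt m → ¬c (_ , lt , m)

  private
    variable
      p q r : Cond

  check-injective : ∀ {i j} → p ⊨ check (el w i) ≐ check (el w j) → i ≡ j
  check-injective {i = i} {j} e = sep (check-≐⁻ (el w i) (el w j) e)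

  -- The Mostowski collapse of a subset of ω₁ in the extension, where S r i
  -- says that r forces i into the subset.
  module Collapse (S : Cond → I → Set ℓ) (S-mono : ∀ {p q i} → S p i → q ⊑ p → S q i) where

    -- Recursion on the tree of the set, rather than along `≺`, keeps the definition structural;
    -- `π-resp` shows that the representation does not matter.
    π : V ℓ → Name
    π (sup K y) = name (Σ K λ k → Σ Cond λ r → Σ I λ i → el w i ≋ y k × S r i)
                       (λ (k , _) → π (y k)) (λ (_ , r , _) → r)

    π-resp : ∀ x y → x ≋ y → p ⊨ π x ≐ π y
    π-resp (sup K x) (sup L y) (mk≋ (f , g)) = ⊆-antisym
      (∀∈I λ _ z z∈ → local (dense-map (∈-name⁻ z∈) λ { _ ((k , r , i , e , h) , q≤r , z≐) →
        let l , c = f k in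
        ∈-respˡ (≐-sym (≐-trans z≐ (π-resp (x k) (y l) (mk≋ c)))) (∈-name (l , r , i , ≋-trans e (mk≋ c) , h) q≤r) }))
      (∀∈I λ _ z z∈ → local (dense-map (∈-name⁻ z∈) λ { _ ((l , r , i , e , h) , q≤r , z≐) →
        let k , c = g l in
        ∈-respˡ (≐-trans (π-resp (x k) (y l) (mk≋ c)) (≐-sym z≐)) (∈-name (k , r , i , ≋-trans e (≋-sym (mk≋ c)) , h) q≤r) }))

    π-∈ : ∀ x {i} → el w i ∊ x → S p i → p ⊨ π (el w i) ∈̇ π x
    π-∈ {p} (sup K y) {i} h s = let k , e = ∊-index h in
      ∈-respˡ (≐-sym (π-resp (el w i) (y k) e)) (∈-name (k , p , i , e , s) ⊑-refl)

    π-∈⁻ : ∀ x {z} → p ⊨ z ∈̇ π x → DenseBelow p (λ q → ∃ λ i → el w i ∊ x × S q i × (q ⊨ z ≐ π (el w i)))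
    π-∈⁻ (sup K y) z∈ = dense-map (∈-name⁻ z∈) λ { _ ((k , r , i , e , h) , q≤r , z≐) →
      i , ∊-intro k e , S-mono h q≤r , ≐-trans z≐ (≐-sym (π-resp (el w i) (y k) e)) }

    -- The least ordinal a which π i may omit is the value of π i below a
    -- condition omitting it, since π i is an initial segment.
    collapse-value : ∀ i → Acc _≺_ i → ∀ p → ∃ λ r → r ⊑ p × ∃ λ a → a ⪯ i × (r ⊨ π (el w i) ≐ check (el w a))
    collapse-value i (acc rs) p =
      let a , (r , r≤p , omit) , a⪯i , min = least Omitted (p , ⊑-refl , omits-self)
      in r , r≤p , a , a⪯i , ⊆-antisym
        (∀∈I λ q≤r z z∈ → local (dense-bind (members z∈) λ s≤q (c , z≐ , down) → λ t t≤s → t , ⊑-refl ,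
          below (mono omit (⊑-trans t≤s (⊑-trans s≤q q≤r))) (mono z≐ t≤s) (mono z∈ (⊑-trans t≤s s≤q)) (mono down t≤s)))
        (∀∈I λ q≤r z z∈ → local (dense-bind (∈-check⁻ z∈) λ s≤q (k , z≐) →
          let c , e = ∊-index (w-transitive (∊-el k) (∊-el a))
              z≐c = ≐-trans z≐ (check-≐ e)
              c≺a = ∊-respˡ e (∊-el k)
          in λ t t≤s → t , ⊑-refl , ∈-respˡ (≐-sym (mono z≐c t≤s))
               (⊨-stable λ (u , u≤t , n) → min c≺a (u , ⊑-trans u≤t (⊑-trans t≤s (⊑-trans s≤q (⊑-trans q≤r r≤p))) , n))))
      where
      Omitted : I → Set (lsuc ℓ)
      Omitted a = ∃ λ r → r ⊑ p × (r ⊨ ¬̇ (check (el w a) ∈̇ π (el w i)))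
      -- The starting point for `least`. Otherwise `i` would be the value of `π j` for some `j ≺ i`,
      -- but that value is at most `j`.
      omits-self : p ⊨ ¬̇ (check (el w i) ∈̇ π (el w i))
      omits-self = ¬I λ _ h →
        let q , _ , j , j≺i , _ , e = dense-here (π-∈⁻ (el w i) h)
            r , r≤q , a , a⪯j , f = collapse-value j (rs j≺i) q
        in ≺-irrefl (⪯-≺-trans (subst (_⪯ j) (sym (check-injective (≐-trans (mono e r≤q) f))) a⪯j) j≺i)
      members : ∀ {q z} → q ⊨ z ∈̇ π (el w i) →
                DenseBelow q (λ r → ∃ λ c → (r ⊨ z ≐ check (el w c)) × (r ⊨ check (el w c) ⊆̇ π (el w i)))
      members z∈ = dense-bind (π-∈⁻ (el w i) z∈) λ _ (j , j≺i , _ , e) → λ t t≤s →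
        let r , r≤t , c , _ , f = collapse-value j (rs j≺i) t in
        r , r≤t , c , ≐-trans (mono e (⊑-trans r≤t t≤s)) f ,
        ∀∈I (λ u≤r d d∈ → local (dense-map (π-∈⁻ (el w j) (∈-respʳ (≐-sym (mono f u≤r)) d∈)) λ _ (k , k≺j , s , g) →
          ∈-respˡ (≐-sym g) (π-∈ (el w i) (≺-trans k≺j j≺i) s)))
      -- With `c` equal to `a` or above it, downward closure would put the omitted `a` into `π i`.
      below : ∀ {a c q z} → q ⊨ ¬̇ (check (el w a) ∈̇ π (el w i)) → q ⊨ z ≐ check (el w c) → q ⊨ z ∈̇ π (el w i) →
              q ⊨ check (el w c) ⊆̇ π (el w i) → q ⊨ z ∈̇ check (el w a)
      below {a} {c} omit z≐ z∈ down with ≺-compare c a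
      ... | inj₁ lt          = ∈-respˡ (≐-sym z≐) (check-∈ lt)
      ... | inj₂ (inj₁ refl) = ⊥-elim (¬E omit (∈-respˡ z≐ z∈))
      ... | inj₂ (inj₂ gt)   = ⊥-elim (¬E omit (∀∈E down (check-∈ gt)))

    -- For `i ≺ j` in the subset, `π i` is a member of `π j`; equality would contradict foundation.
    π-injective : ∀ {i j} → S p i → S p j → p ⊨ π (el w i) ≐ π (el w j) → i ≡ j
    π-injective {i = i} {j} s t e with ≺-compare i j
    ... | inj₁ lt        = ⊥-elim (∈-irrefl (π (el w i)) (≐-sym e) (π-∈ (el w j) lt s))
    ... | inj₂ (inj₁ eq) = eq
    ... | inj₂ (inj₂ gt) = ⊥-elim (∈-irrefl (π (el w j)) e (π-∈ (el w i) gt t))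

    module _ (ccc : CCC) (unbounded : ∀ γ {q} → q ⊑ p → ∃ λ r → r ⊑ q × ∃ λ i → γ ≺ i × S r i) where

      -- If a is not attained below q, the possible members of the subset below q
      -- are coloured by their collapses, which are countably many ordinals below a.
      π-onto : ∀ a {q} → q ⊑ p → ∃ λ r → r ⊑ q × ∃ λ i → S r i × (r ⊨ π (el w i) ≐ check (el w a))
      π-onto a {q} q≤p = by-contradiction λ none →
        let γ , below-γ = bounded {Possible} proj₁ (proj₁ (colours none)) (λ eq → cong proj₁ (proj₂ (colours none) eq))
            r , r≤q , i , γ≺i , s = unbounded γ q≤p
        in ≺-irrefl (≺-trans γ≺i (below-γ (i , possible (r , r≤q , s))))
        where
        possible? : I → Bool
        possible? i = does (em↓ {∃ λ r → r ⊑ q × S r i})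
        possible : ∀ {i} → (∃ λ r → r ⊑ q × S r i) → T (possible? i)
        possible {i} h with em↓ {∃ λ r → r ⊑ q × S r i}
        ... | yes _ = tt
        ... | no ¬h = ¬h h
        witness : ∀ {i} → T (possible? i) → ∃ λ r → r ⊑ q × S r i
        witness {i} t with em↓ {∃ λ r → r ⊑ q × S r i}
        ... | yes h = h
        Possible : Set ℓ
        Possible = Σ I λ i → T (possible? i)
        Possible-≡ : ∀ {s t : Possible} → proj₁ s ≡ proj₁ t → s ≡ t
        Possible-≡ {i , b} {_ , c} refl = cong (i ,_) (T-irrelevant b c)
        value : (t : Possible) → ∃ λ r → r ⊑ q × S r (proj₁ t) × ∃ λ c → r ⊨ π (el w (proj₁ t)) ≐ check (el w c)
        value (i , t) = let r , r≤q , s = witness t ; r′ , r′≤r , c , _ , e = collapse-value i (≺-wf i) r in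
          r′ , ⊑-trans r′≤r r≤q , S-mono s r′≤r , c , e
        condition : Possible → Cond
        condition t = proj₁ (value t)
        colour : Possible → I
        colour t = proj₁ (proj₂ (proj₂ (proj₂ (value t))))
        Attained : Set (lsuc ℓ)
        Attained = ∃ λ r → r ⊑ q × ∃ λ i → S r i × (r ⊨ π (el w i) ≐ check (el w a))
        -- Values form an initial segment: if `c` were above `a`, then `a` would be a member of
        -- `π i`, hence itself the collapse of some `j`.
        ≐⇒≺a : ¬ Attained → ∀ {r i c} → r ⊑ q → S r i → r ⊨ π (el w i) ≐ check (el w c) → c ≺ a
        ≐⇒≺a none {r} {i} {c} r≤q s e with ≺-compare c a
        ... | inj₁ lt          = lt
        ... | inj₂ (inj₁ refl) = ⊥-elim (none (r , r≤q , i , s , e))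
        ... | inj₂ (inj₂ gt)   =
          let r′ , r′≤r , j , _ , s′ , f = dense-here (π-∈⁻ (el w i) (∈-respʳ (≐-sym e) (check-∈ gt)))
          in ⊥-elim (none (r′ , ⊑-trans r′≤r r≤q , j , s′ , ≐-sym f))
        colour≺a : ¬ Attained → ∀ t → colour t ≺ a
        colour≺a none t = let _ , r≤q , s , _ , e = value t in ≐⇒≺a none r≤q s e
        same : ∀ {s t} → colour s ≡ colour t → Compatible (condition s) (condition t) → s ≡ t
        same {s} {t} eq (u , u≤s , u≤t) =
          let _ , _ , sₛ , _ , e = value s ; _ , _ , sₜ , _ , f = value t in
          Possible-≡ (π-injective (S-mono sₛ u≤s) (S-mono sₜ u≤t)
            (≐-trans (mono e u≤s) (≐-trans (check-≐ (≡⇒≋ (cong (el w) eq))) (≐-sym (mono f u≤t)))))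
        colours : ¬ Attained → ∃ λ (e : Possible → ℕ) → ∀ {s t} → e s ≡ e t → s ≡ t
        colours none = colouring ccc Possible condition (λ t → proj₁ (segment a) (colour t))
          λ {s} {t} eq → same (proj₂ (segment a) (colour≺a none s) (colour≺a none t) eq)

-- A ground family of sets that may enter `A`

module UncountableFamily {ℓ} (em : ExcludedMiddle (lsuc ℓ)) (ext : Extensionality (lsuc ℓ) (lsuc ℓ))
  (P : Poset ℓ ℓ ℓ) {w : V ℓ} (sep : Choice.Separated em ext w)
  (w-transitive : ∀ {x y} → x ∊ y → y ∊ w → x ∊ w) (isOmega : IsOmega₁ (Ix w) (λ i j → el w i ∊ el w j)) where

  open Choice em ext
  open Universe em ext
  open OnePoint ℓ using (V-resp)
  open Names P
  open Functions P
  open Naturals em P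
  open Cardinality em ext P
  open Preservation em ext P using (image-finiteSubset)
  open IsOmega₁ isOmega
  open Omega₁ em ext isOmega
  open Uncountable em ext P sep w-transitive isOmega

  private
    variable
      p q : Cond

  image-∊ : ∀ {k} (s : Fin k → I) m → el w (s m) ∊ image w s
  image-∊ s m = ∊-el {x = image w s} (lift m)

  module _ (A : Name) where

    -- The successor in `Fin (suc k)` makes the set nonempty. The condition `r` may vary with `γ`.
    Beyond : Cond → I → Set (lsuc ℓ)
    Beyond p γ = ∃ λ r → r ⊑ p × ∃ λ k → Σ (Fin (suc k) → I) λ s →
                 (∀ m → γ ≺ s m) × (r ⊨ check (image w s) ∈̇ A)

    module _ {p} (subsets : p ⊨ all∈ A (λ x → finiteSubset x (check w))) (disj : p ⊨ pairwiseDisjoint A) where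

      shared⇒≋ : ∀ {x y z} → q ⊑ p → q ⊨ check x ∈̇ A → q ⊨ check y ∈̇ A → z ∊ x → z ∊ y → x ≋ y
      shared⇒≋ {x = x} {y} {z} q≤p x∈ y∈ z∈x z∈y with em↓ {x ≋ y}
      ... | yes e = e
      ... | no ¬e = ⊥-elim (¬E (⇒E (∀∈E (∀∈E (mono disj q≤p) x∈) y∈) (¬I λ _ e → ¬e (check-≐⁻ x y e)))
                      (∃I (check z) (∧I (check-∈ z∈x) (check-∈ z∈y))))

      -- If no member of A lies beyond γ then a nonempty member of A is
      -- determined by any of its elements ⪯ γ, and these are countably many.
      ¬Beyond⇒countable : ∀ γ → ¬ Beyond p γ → p ⊨ countable A
      ¬Beyond⇒countable γ none = countable-graph {X = A} set
        (λ q l n → (q ⊩ check (image w (proj₂ l)) ∈ⁿ A) × n ≡ code l)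
        (λ { {i = _ , s} (h , eq) r≤q → lower (un⊨ (mono (mk⊨ {φ = check (image w s) ∈̇ A} (lift h)) r≤q)) , eq })
        (λ _ (h , _) → mk⊨ (lift h))
        (λ q≤p u∈ → let sub = ∀∈E (mono subsets q≤p) u∈ in
          dense-map (finite-subset {y = w} (∧E₁ sub) (∧E₂ sub)) λ r≤q (k , s , e) →
            (k , s) , code (k , s) , (lower (un⊨ (∈-respˡ e (mono u∈ r≤q))) , refl) , e)
        (λ { {i = l} {i′ = l′} _ (_ , refl) (_ , refl) e → code-cong l l′ (check-≐⁻ (set₀ l) (set₀ l′) e) })
        (λ { {i = l} {i′ = l′} q≤p (h , e) (h′ , e′) → check-≐ (code-injective l l′ q≤p (mk⊨ (lift h)) (mk⊨ (lift h′)) (trans (sym e) e′)) })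
        where
        List : Set ℓ
        List = Σ ℕ λ k → Fin k → I
        set₀ : List → V ℓ
        set₀ (_ , s) = image w s
        set : List → Name
        set l = check (set₀ l)
        Low : List → I → Set ℓ
        Low l i = i ⪯ γ × el w i ∊ set₀ l
        e : I → ℕ
        e = proj₁ (closed-segment γ)
        -- 0 is kept for lists with no element up to `γ`; such a member of `A` must be empty. As
        -- `pick` depends only on the predicate, all enumerations of one set receive the same code.
        code : List → ℕ
        code l = maybe (λ i → suc (e i)) 0 (pick (Low l))
        code-cong : ∀ l l′ → set₀ l ≋ set₀ l′ → code l ≡ code l′
        code-cong l l′ eq = cong (maybe (λ i → suc (e i)) 0)
          (pick-cong (λ i (h , k) → h , ∊-respʳ eq k) (λ i (h , k) → h , ∊-respʳ (≋-sym eq) k))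
        no-low⇒empty : ∀ l → q ⊑ p → q ⊨ set l ∈̇ A → pick (Low l) ≡ nothing → ∀ {x} → ¬ (x ∊ set₀ l)
        no-low⇒empty (zero , s) _ _ _ h with () ← lower (proj₁ (∊-index h))
        no-low⇒empty {q} (suc k , s) q≤p l∈ eq h = none (q , q≤p , k , s , high , l∈)
          where
          high : ∀ m → γ ≺ s m
          high m with ≺-compare γ (s m)
          ... | inj₁ lt = lt
          ... | inj₂ ge with pick-complete {Q = Low (suc k , s)} {s m} ([ (λ e → inj₂ (sym e)) , inj₁ ]′ ge , image-∊ s m)
          ...   | _ , eq′ with () ← trans (sym eq) eq′
        code-injective : ∀ l l′ → q ⊑ p → q ⊨ set l ∈̇ A → q ⊨ set l′ ∈̇ A → code l ≡ code l′ → set₀ l ≋ set₀ l′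
        code-injective l l′ q≤p h h′ eq = go (pick (Low l)) (pick (Low l′)) refl refl eq
          where
          go : ∀ a b → pick (Low l) ≡ a → pick (Low l′) ≡ b →
               maybe (λ i → suc (e i)) 0 a ≡ maybe (λ i → suc (e i)) 0 b → set₀ l ≋ set₀ l′
          go nothing nothing f g _ = ≋-ext (λ i → ⊥-elim (no-low⇒empty l q≤p h f (∊-el i)))
                                           (λ i → ⊥-elim (no-low⇒empty l′ q≤p h′ g (∊-el i)))
          go nothing (just _) _ _ ()
          go (just _) nothing _ _ ()
          go (just i) (just j) f g eq =
            let i⪯ , i∈ = pick-sound f ; j⪯ , j∈ = pick-sound g
                i≡j = proj₂ (closed-segment γ) i⪯ j⪯ (ℕ.suc-injective eq)
            in shared⇒≋ q≤p h h′ i∈ (subst (λ k → el w k ∊ set₀ l′) (sym i≡j) j∈)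

  module Sparse (A : Name) {p} (beyond : ∀ γ → Beyond A p γ) where

    size : I → ℕ
    size γ = proj₁ (proj₂ (proj₂ (beyond γ)))
    elements : ∀ γ → Fin (suc (size γ)) → I
    elements γ = proj₁ (proj₂ (proj₂ (proj₂ (beyond γ))))
    top : I → I
    top γ = elements γ (proj₁ (maximum (elements γ)))

    -- For `i ≺ j` the recursion gives `top (g i) ≺ g j`, and the elements chosen for `g j` all
    -- exceed `g j`; hence the finite sets come in consecutive blocks.
    g : I → I
    g = proj₁ (sparse top)

    member : I → V ℓ
    member i = image w (elements (g i))

    condition : I → Cond
    condition i = proj₁ (beyond (g i))

    condition-⊑ : ∀ i → condition i ⊑ p
    condition-⊑ i = proj₁ (proj₂ (beyond (g i)))

    member-forced : ∀ i → condition i ⊨ check (member i) ∈̇ A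
    member-forced i = proj₂ (proj₂ (proj₂ (proj₂ (proj₂ (beyond (g i))))))

    family : V ℓ
    family = sup I member

    increasing : ∀ {i j} → i ≺ j → ∀ m n → elements (g i) m ≺ elements (g j) n
    increasing {i} {j} lt m n = ⪯-≺-trans (proj₂ (maximum (elements (g i))) m)
      (≺-trans (proj₂ (sparse top) lt) (proj₁ (proj₂ (proj₂ (proj₂ (proj₂ (beyond (g j)))))) n))

    apart : ∀ {i j} → i ≺ j → ∀ {z} → z ∊ member i → ¬ (z ∊ member j)
    apart {i} {j} lt h k =
      let m , e = ∊-index h ; n , f = ∊-index k in
      ≺-irrefl (subst (elements (g i) (lower m) ≺_) (sym (sep (≋-trans (≋-sym e) f))) (increasing lt (lower m) (lower n)))

    shared⇒≡ : ∀ {i j z} → z ∊ member i → z ∊ member j → i ≡ j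
    shared⇒≡ {i} {j} h k with ≺-compare i j
    ... | inj₁ lt        = ⊥-elim (apart lt h k)
    ... | inj₂ (inj₁ eq) = eq
    ... | inj₂ (inj₂ gt) = ⊥-elim (apart gt k h)

    member-injective : ∀ {i j} → member i ≋ member j → i ≡ j
    member-injective {i} {j} e = shared⇒≡ {i} {j} (image-∊ (elements (g i)) zero) (∊-respʳ e (image-∊ (elements (g i)) zero))

    family-subsets : V⊨ all∈ family (λ x → finiteSubset x w)
    family-subsets x x∈ = let i , e = ∊-index (∊↓ x∈) in
      V-resp (finiteSubset 0 1) 2 {env₂ (member i) w} {env₂ x w} (λ { zero → ≋-sym e ; (suc _) → ≋-refl })
        (image-finiteSubset w (elements (g i)))

    family-uncountable : V⊨ ¬̇ countable family
    family-uncountable h = let e , e-inj = countable⇒Countable {x = family} h in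
      uncountable e λ eq → member-injective (e-inj eq)

    family-disjoint : V⊨ pairwiseDisjoint family
    family-disjoint x x∈ y y∈ x≢y (z , z∈x , z∈y) =
      let i , e = ∊-index (∊↓ x∈) ; j , f = ∊-index (∊↓ y∈)
          i≡j = shared⇒≡ {i} {j} (∊-respʳ e (∊↓ z∈x)) (∊-respʳ f (∊↓ z∈y))
      in x≢y (lift (un≋ (≋-trans e (≋-trans (≡⇒≋ (cong member i≡j)) (≋-sym f)))))

    -- A listing, without repetitions and indexed by ω₁, of sets common to `family` and `B`, read
    -- off from the inverse of the bijection in (K2). `source` retains which condition forces each
    -- of them into `A`.
    record Captured (F : V ℓ) : Set (lsuc ℓ) where
      field
        B         : V ℓ
        B∈F       : B ∊ F
        at        : I → Ix B
        source    : I → I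
        at-≋      : ∀ j → member (source j) ≋ el B (at j)
        injective : ∀ {i j} → el B (at i) ≋ el B (at j) → i ≡ j

    captured : ∀ {F} → V⊨ K2 w F → Captured F
    captured {F} k2 = from (k2 family (family-subsets , family-uncountable , family-disjoint))
      where
      from : V⊨ ex∈ F (λ B → ∃̇[ C ] isIntersection C family B ∧̇ C ≃̇ w) → Captured F
      from (B , B∈ , C , inter , f , (fun , _) , onto) = record
        { B = B ; B∈F = ∊↓ B∈ ; at = λ j → proj₁ (in-B j) ; source = λ j → proj₁ (in-family j)
        ; at-≋ = λ j → ≋-trans (≋-sym (proj₂ (in-family j))) (proj₂ (in-B j))
        ; injective = λ {i} {j} e → same i j (≋-trans (proj₂ (in-B i)) (≋-trans e (≋-sym (proj₂ (in-B j)))))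
        }
        where
        u : I → V ℓ
        u j = proj₁ (onto (el w j) (∊↑ (∊-el j)))
        u∈C : ∀ j → V⊨ u j ∈̇ C
        u∈C j = proj₁ (proj₂ (onto (el w j) (∊↑ (∊-el j))))
        u-maps : ∀ j → V⊨ maps f (u j) (el w j)
        u-maps j = proj₂ (proj₂ (onto (el w j) (∊↑ (∊-el j))))
        in-both : ∀ j → V⊨ u j ∈̇ family ∧̇ u j ∈̇ B
        in-both j = proj₁ (inter (u j)) (u∈C j)
        in-family : ∀ j → ∃ λ i → u j ≋ member i
        in-family j = ∊-index (∊↓ (proj₁ (in-both j)))
        in-B : ∀ j → ∃ λ b → u j ≋ el B b
        in-B j = ∊-index (∊↓ (proj₂ (in-both j)))
        same : ∀ i j → u i ≋ u j → i ≡ j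
        same i j e =
          let _ , _ , _ , unique = proj₂ fun (u i) (u∈C i)
              m = V-resp (maps 0 1 2) 3 {env₃ f (u j) (el w j)} {env₃ f (u i) (el w j)}
                    (λ { zero → ≋-refl ; (suc zero) → ≋-sym e ; (suc (suc _)) → ≋-refl }) (u-maps j)
          in sep (≋-trans (mk≋ (lower (unique (el w i) (u-maps i)))) (≋-sym (mk≋ (lower (unique (el w j) m)))))

-- The size of `A ∩ B` in the extension

module UncountableIntersection {ℓ} (em : ExcludedMiddle (lsuc ℓ)) (ext : Extensionality (lsuc ℓ) (lsuc ℓ))
  (P : Poset ℓ ℓ ℓ) {w : V ℓ} (sep : Choice.Separated em ext w)
  (w-transitive : ∀ {x y} → x ∊ y → y ∊ w → x ∊ w) (isOmega : IsOmega₁ (Ix w) (λ i j → el w i ∊ el w j)) where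

  open Choice em ext
  open Universe em ext
  open Names P
  open Functions P
  open Naturals em P
  open Cardinality em ext P
  open IsOmega₁ isOmega
  open Omega₁ em ext isOmega
  open Uncountable em ext P sep w-transitive isOmega
  open UncountableFamily em ext P sep w-transitive isOmega

  private
    variable
      p q : Cond

  max-index : ∀ {x} → (∀ {z} → z ∊ x → z ∊ w) → Finite x → (∃ λ z → z ∊ x) →
              ∃ λ μ → el w μ ∊ x × (∀ {i} → el w i ∊ x → i ⪯ μ)
  max-index sub (zero , s , onto) (z , z∈) with () ← proj₁ (onto (proj₁ (∊-index z∈)))
  max-index {x} sub (suc k , s , onto) _ =
    t m , ∊-respˡ (t-≋ m) (∊-el (s m)) , λ {i} h →
      let j , e = ∊-index h ; n , f = onto j in
      subst (_⪯ t m) (sep (≋-trans (≋-sym (t-≋ n)) (≋-trans (≋-sym f) (≋-sym e)))) (proj₂ (maximum t) n)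
    where
    t : Fin (suc k) → I
    t m = proj₁ (∊-index (sub (∊-el (s m))))
    t-≋ : ∀ m → el x (s m) ≋ el w (t m)
    t-≋ m = proj₂ (∊-index (sub (∊-el (s m))))
    m : Fin (suc k)
    m = proj₁ (maximum t)

  module _ {B : V ℓ} (subsets : V⊨ all∈ B (λ x → finiteSubset x w ∧̇ nonempty x)) (nonoverlapping : V⊨ nonOverlapping B) where

    private
      in-w : ∀ b {z} → z ∊ el B b → z ∊ w
      in-w b h = ∊↓ (proj₁ (proj₁ (subsets (el B b) (∊↑ (∊-el b)))) _ (∊↑ h))

      max : ∀ b → ∃ λ μ → el w μ ∊ el B b × (∀ {i} → el w i ∊ el B b → i ⪯ μ)
      max b = let (_ , fin) , z , z∈ = subsets (el B b) (∊↑ (∊-el b)) in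
        max-index (in-w b) (finite⇒Finite fin) (z , ∊↓ z∈)

    -- Maxima turn members of the non-overlapping `B` into ordinals, one for each, so that `A ∩ B`
    -- becomes a set of ordinals that can be collapsed.
    μ : Ix B → I
    μ b = proj₁ (max b)

    ⪯-antisym : ∀ {i j} → i ⪯ j → j ⪯ i → i ≡ j
    ⪯-antisym (inj₂ eq) _ = eq
    ⪯-antisym (inj₁ lt) ge = ⊥-elim (≺-irrefl (≺-⪯-trans lt ge))

    μ-resp : ∀ {b c} → el B b ≋ el B c → μ b ≡ μ c
    μ-resp {b} {c} e = ⪯-antisym (proj₂ (proj₂ (max c)) (∊-respʳ e (proj₁ (proj₂ (max b)))))
                                 (proj₂ (proj₂ (max b)) (∊-respʳ (≋-sym e) (proj₁ (proj₂ (max c)))))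

    max<min⇒≺ : ∀ {b c} → V⊨ el B b max<min el B c → μ b ≺ μ c
    max<min⇒≺ {b} {c} (m , n , (m∈ , m-max) , (n∈ , n-min) , m∈n) =
      let i , e = ∊-index (in-w b (∊↓ m∈)) ; j , f = ∊-index (in-w c (∊↓ n∈))
          i≺j = ∊-respˡ e (∊-respʳ f (∊↓ m∈n))
          b⪯i = [ (λ h → inj₁ (∊-respʳ e (∊↓ h))) , (λ h → inj₂ (sep (≋-trans (mk≋ (lower h)) e))) ]′
                  (m-max (el w (μ b)) (∊↑ (proj₁ (proj₂ (max b)))))
          j⪯c = [ (λ h → inj₁ (∊-respˡ f (∊↓ h))) , (λ h → inj₂ (sep (≋-trans (≋-sym f) (mk≋ (lower h))))) ]′
                  (n-min (el w (μ c)) (∊↑ (proj₁ (proj₂ (max c)))))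
      in ⪯-≺-trans b⪯i (≺-⪯-trans i≺j j⪯c)

    μ-injective : ∀ {b c} → μ b ≡ μ c → el B b ≋ el B c
    μ-injective {b} {c} eq = lower (by-contradiction λ ¬e →
      [ (λ h → ≺-irrefl (subst (μ b ≺_) (sym eq) (max<min⇒≺ {b} {c} h)))
      , (λ h → ≺-irrefl (subst (μ c ≺_) eq (max<min⇒≺ {c} {b} h))) ]′
      (nonoverlapping (el B b) (∊↑ (∊-el b)) (el B c) (∊↑ (∊-el c)) λ e → ¬e (lift (mk≋ (lower e)))))

  module Intersection {B : V ℓ} (μ : Ix B → I) (μ-resp : ∀ {b c} → el B b ≋ el B c → μ b ≡ μ c)
                      (μ-injective : ∀ {b c} → μ b ≡ μ c → el B b ≋ el B c) (ccc : CCC) (A : Name) where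

    -- r forces i to be the maximum of a member of A ∩ B
    S : Cond → I → Set ℓ
    S r i = Σ (Ix B) λ b → μ b ≡ i × r ⊩ check (el B b) ∈ⁿ A

    S-mono : ∀ {i} → S p i → q ⊑ p → S q i
    S-mono (b , eq , h) q≤p = b , eq , ∈ⁿ-mono (check (el B b)) A h q≤p

    Unbounded : Cond → Set ℓ
    Unbounded p = ∀ γ {q} → q ⊑ p → ∃ λ r → r ⊑ q × ∃ λ i → γ ≺ i × S r i

    -- Suppose not. Then no `c i` is itself `Unbounded`, so each has an extension forcing all maxima
    -- to stay at or below some ordinal. Since the maxima `μ (b i)` are unbounded in V, `sparse` can
    -- pick indices whose maxima pass all earlier bounds.
    unbounded-below : ∀ (c : I → Cond) (b : I → Ix B) → (∀ i → c i ⊑ p) → (∀ i → c i ⊨ check (el B (b i)) ∈̇ A) →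
                      (∀ {i j} → el B (b i) ≋ el B (b j) → i ≡ j) → ∃ λ q → q ⊑ p × Unbounded q
    unbounded-below {p} c b c⊑p forced b-inj with em↓ {∃ λ q → q ⊑ p × Unbounded q}
    ... | yes h = h
    ... | no ¬h = ⊥-elim (uncountable (proj₁ coloured) (proj₂ coloured))
      where
      Bounding : Cond → I → Set ℓ
      Bounding q γ = ∀ {r} → r ⊑ q → ∀ {i} → γ ≺ i → ¬ S r i
      bound : ∀ i → ∃ λ γ → ∃ λ q → q ⊑ c i × Bounding q γ
      bound i with em↓ {∃ λ γ → ∃ λ q → q ⊑ c i × Bounding q γ}
      ... | yes k = k
      ... | no ¬k = ⊥-elim (¬h (c i , c⊑p i , λ γ {q} q≤c → attained γ q q≤c))
        where
        attained : ∀ γ q → q ⊑ c i → ∃ λ r → r ⊑ q × ∃ λ j → γ ≺ j × S r j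
        attained γ q q≤c with em↓ {∃ λ r → r ⊑ q × ∃ λ j → γ ≺ j × S r j}
        ... | yes l = l
        ... | no ¬l = ⊥-elim (¬k (γ , q , q≤c , λ r≤q lt s → ¬l (_ , r≤q , _ , lt , s)))
      above : ∀ γ → ∃ λ i → γ ≺ μ (b i)
      above = injective⇒unbounded (λ i → μ (b i)) (λ eq → b-inj (μ-injective eq))
      J : I → I
      J γ = proj₁ (above γ)
      limit-of : I → I
      limit-of γ = proj₁ (bound (J γ))
      g : I → I
      g = proj₁ (sparse limit-of)
      condition : I → Cond
      condition i = proj₁ (proj₂ (bound (J (g i))))
      -- The later condition extends `c (J (g j))`, which forces into `A` a member with maximum
      -- above `g j`, hence above the bound that the earlier condition imposes.
      incompatible : ∀ {i j} → i ≺ j → ¬ Compatible (condition i) (condition j)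
      incompatible {i} {j} lt (r , r≤i , r≤j) =
        proj₂ (proj₂ (proj₂ (bound (J (g i))))) r≤i (≺-trans (proj₂ (sparse limit-of) lt) (proj₂ (above (g j))))
          (b (J (g j)) , refl , lower (un⊨ (mono (forced (J (g j))) (⊑-trans r≤j (proj₁ (proj₂ (proj₂ (bound (J (g j))))))))))
      coloured : ∃ λ (e : I → ℕ) → ∀ {i j} → e i ≡ e j → i ≡ j
      -- A single colour suffices: all these conditions form one antichain.
      coloured = colouring ccc I condition (λ _ → 0) λ {i} {j} _ comp →
        [ (λ lt → ⊥-elim (incompatible lt comp))
        , [ (λ eq → eq) , (λ gt → ⊥-elim (incompatible gt (let r , a , d = comp in r , d , a))) ]′ ]′ (≺-compare i j)

    intersection : Name
    intersection = name (Σ (Ix B) λ b → Σ Cond λ r → r ⊩ check (el B b) ∈ⁿ A) (λ (b , _) → check (el B b)) (λ (_ , r , _) → r)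

    intersection-∈ : ∀ b → q ⊨ check (el B b) ∈̇ A → q ⊨ check (el B b) ∈̇ intersection
    intersection-∈ {q} b h = ∈-name (b , q , lower (un⊨ h)) ⊑-refl

    intersection-∈⁻ : ∀ {x} → q ⊨ x ∈̇ intersection → DenseBelow q (λ r → ∃ λ b → (r ⊨ x ≐ check (el B b)) × (r ⊨ check (el B b) ∈̇ A))
    intersection-∈⁻ h = dense-map (∈-name⁻ h) λ { _ ((b , _ , k) , q≤r , e) → b , e , mono (mk⊨ (lift k)) q≤r }

    intersection-isIntersection : p ⊨ isIntersection intersection A (check B)
    intersection-isIntersection = ∀I λ x → ∧I
      (⇒I λ _ h → local (dense-map (intersection-∈⁻ h) λ _ (b , e , k) →
        ∧I (∈-respˡ (≐-sym e) k) (∈-respˡ (≐-sym e) (∈-check-el b))))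
      (⇒I λ _ h → local (dense-map (∈-check⁻ (∧E₂ h)) λ r≤q (b , e) →
        ∈-respˡ (≐-sym e) (intersection-∈ b (∈-respˡ e (mono (∧E₁ h) r≤q)))))

    open Collapse S S-mono

    -- The relation whose `graph` is the bijection: a member of `A ∩ B` goes to the collapse of its
    -- maximum. Both conjuncts are atomic, hence in `Set ℓ`.
    Collapses : Cond → Ix B → I → Set ℓ
    Collapses r b a = (r ⊩ check (el B b) ∈ⁿ A) × (r ⊩ π (el w (μ b)) ≈ⁿ check (el w a))

    Collapses-mono : ∀ {b a} → Collapses p b a → q ⊑ p → Collapses q b a
    Collapses-mono {b = b} {a} (h , k) q≤p =
      ∈ⁿ-mono (check (el B b)) A h q≤p , ≈ⁿ-mono (π (el w (μ b))) (check (el w a)) k q≤p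

    collapses-functional : ∀ {b a b′ a′} → Collapses q b a → Collapses q b′ a′ →
                           q ⊨ check (el B b) ≐ check (el B b′) → q ⊨ check (el w a) ≐ check (el w a′)
    collapses-functional {b = b} {a} {b′} {a′} (_ , k) (_ , k′) e =
      ≐-trans (≐-sym (mk⊨ (lift k))) (≐-trans (π-resp (el w (μ b)) (el w (μ b′))
        (≡⇒≋ (cong (el w) (μ-resp (check-≐⁻ (el B b) (el B b′) e))))) (mk⊨ (lift k′)))

    collapses-injective : ∀ {b a b′ a′} → Collapses q b a → Collapses q b′ a′ →
                          q ⊨ check (el w a) ≐ check (el w a′) → q ⊨ check (el B b) ≐ check (el B b′)
    collapses-injective {b = b} {a} {b′} {a′} (h , k) (h′ , k′) e =
      check-≐ (μ-injective (π-injective (b , refl , h) (b′ , refl , h′)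
        (≐-trans (mk⊨ (lift k)) (≐-trans e (≐-sym (mk⊨ (lift k′)))))))

    collapses-total : ∀ {u} → q ⊨ u ∈̇ intersection →
                      DenseBelow q (λ r → ∃ λ b → ∃ λ a → Collapses r b a × (r ⊨ u ≐ check (el B b)))
    collapses-total u∈ = dense-bind (intersection-∈⁻ u∈) λ _ (b , e , h) → λ r r≤q →
      let s , s≤r , a , _ , f = collapse-value (μ b) (≺-wf (μ b)) r
          s≤q = ⊑-trans s≤r r≤q
      in s , s≤r , b , a , (lower (un⊨ (mono h s≤q)) , lower (un⊨ f)) , mono e s≤q

    collapses-intro : ∀ {i a} → S q i → q ⊨ π (el w i) ≐ check (el w a) → ∃ λ b → Collapses q b a
    collapses-intro (b , refl , h) f = b , h , lower (un⊨ f)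

    collapses-onto : Unbounded p → ∀ {q v} → q ⊑ p → q ⊨ v ∈̇ check w →
                     DenseBelow q (λ r → ∃ λ b → ∃ λ a → Collapses r b a × (r ⊨ v ≐ check (el w a)))
    collapses-onto {p} unbounded {q} {v} q≤p v∈ = dense-bind (∈-check⁻ v∈) λ r≤q (a , e) → at a (⊑-trans r≤q q≤p) e
      where
      at : ∀ {r} a → r ⊑ p → r ⊨ v ≐ check (el w a) →
           DenseBelow r (λ s → ∃ λ b → ∃ λ a → Collapses s b a × (s ⊨ v ≐ check (el w a)))
      at a r≤p e s s≤r =
        let t , t≤s , _ , m , f = π-onto ccc unbounded a (⊑-trans s≤r r≤p)
            b , c = collapses-intro m f
        in t , t≤s , b , a , c , mono e (⊑-trans t≤s s≤r)

    open Graph {Ix B} {I} (λ b → check (el B b)) (λ a → check (el w a)) Collapses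
      (λ {p} {q} {b} {a} → Collapses-mono {p} {q} {b} {a})

    intersection-≃ : Unbounded p → p ⊨ intersection ≃̇ check w
    intersection-≃ {p} unbounded = ∃I graph (graph-bijection {p} {intersection} {check w}
      (λ {_} {b} _ (h , _) → intersection-∈ b (mk⊨ (lift h)))
      (λ {_} {_} {a} _ _ → ∈-check-el a)
      (λ _ → collapses-total)
      (λ {q} {b} {a} {b′} {a′} _ → collapses-functional {q} {b} {a} {b′} {a′})
      (λ {q} {b} {a} {b′} {a′} _ → collapses-injective {q} {b} {a} {b′} {a′})
      (collapses-onto unbounded))

  check-K2 : CCC → ∀ {F} → V⊨ familiesOn w F → V⊨ K2 w F → p ⊨ K2 (check w) (check F)
  -- `B` is found anew below each `q`, so the existential is proved densely.
  check-K2 ccc {F} fam k2 = ∀I λ A → ⇒I λ _ h → ∃I-dense λ q q≤p →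
    capture A (mono (∧E₁ h) q≤p) (mono (∧E₁ (∧E₂ h)) q≤p) (mono (∧E₂ (∧E₂ h)) q≤p)
    where
    capture : ∀ {q} A → q ⊨ all∈ A (λ x → finiteSubset x (check w)) → q ⊨ ¬̇ countable A → q ⊨ pairwiseDisjoint A →
              ∃ λ r → r ⊑ q × ∃ λ B → r ⊨ B ∈̇ check F ∧̇ (∃̇[ C ] isIntersection C A B ∧̇ C ≃̇ check w)
    capture {q} A subsets unc disj = proj₁ unb , proj₁ (proj₂ unb) , check B , ∧I (check-∈ B∈F)
      (∃I (intersection)
        (∧I (intersection-isIntersection)
            (intersection-≃ (proj₂ (proj₂ unb)))))
      where
      beyond : ∀ γ → Beyond A q γ
      beyond γ = by-contradiction λ none → ¬E unc (¬Beyond⇒countable A subsets disj γ none)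
      open Sparse A beyond
      open Captured (captured k2)
      B-subsets : V⊨ all∈ B (λ x → finiteSubset x w ∧̇ nonempty x)
      B-subsets = proj₁ (fam B (∊↑ B∈F))
      B-nonoverlapping : V⊨ nonOverlapping B
      B-nonoverlapping = proj₂ (fam B (∊↑ B∈F))
      open Intersection {B} (μ B-subsets B-nonoverlapping) (μ-resp B-subsets B-nonoverlapping)
             (μ-injective B-subsets B-nonoverlapping) ccc A
      unb : ∃ λ r → r ⊑ q × Unbounded r
      unb = unbounded-below (λ j → condition (source j)) at
        (λ j → condition-⊑ (source j)) (λ j → ∈-respˡ (check-≐ (at-≋ j)) (member-forced (source j))) injective

-- All clauses together, with ω₁ as a parameter

isThinKurepaOn : ∀ {a} {X : Set a} → X → X → Formula X
isThinKurepaOn w F = isω₁ w ∧̇ familiesOn w F ∧̇ K1 w F ∧̇ K2 w F ∧̇ K3 w F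

check-isThinKurepaOn : ∀ {ℓ} (em : ExcludedMiddle (lsuc ℓ)) (ext : Extensionality (lsuc ℓ) (lsuc ℓ)) (P : Poset ℓ ℓ ℓ) →
  let open Names P in CCC → ∀ {w F} → Choice.Separated em ext w → V⊨ isThinKurepaOn w F → ∀ {p} → p ⊨ isThinKurepaOn (check w) (check F)
check-isThinKurepaOn em ext P ccc {w} {F} sep (ω₁ , fam , k1 , k2 , k3) =
  ∧I (check-isω₁ ccc ω₁) (∧I (check-familiesOn {w = w} {F} fam) (∧I (check-K1 {w = w} {F} k1)
    (∧I (check-K2 ccc {F = F} fam k2) (check-K3 {w = w} {F} k3))))
  where
  open Names P using (∧I)
  open Preservation em ext P
  open UncountableIntersection em ext P {w} sep
    (λ {x} {y} x∈ y∈ → ∊↓ (proj₁ (proj₁ ω₁) y (∊↑ y∈) x (∊↑ x∈))) (Omega₁Index.isOmega₁ em ext sep ω₁)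

lemma4 : ∀ {ℓ} → ExcludedMiddle (lsuc ℓ) → Extensionality (lsuc ℓ) (lsuc ℓ) →
    (F : V ℓ) → V⊨ thinKurepa F →
    (P : Poset ℓ ℓ ℓ) → Forcing.CCC P →
    let open Forcing P in ⊩ thinKurepa (check F)
lemma4 {ℓ} em ext F (w , kurepa) P ccc p = un⊨ (∃I {Θ = λ w → isThinKurepaOn w (check F)} (check w₀)
  (check-isThinKurepaOn em ext P ccc {w₀} {F} (normal-separated w) kurepa₀))
  where
  open Names P
  open Choice em ext
  -- The given ω₁ may list an element several times; its copy without repetitions is the same set,
  -- so `V-resp` carries the hypotheses over.
  w₀ : V ℓ
  w₀ = normal w
  kurepa₀ : V⊨ isThinKurepaOn w₀ F
  kurepa₀ = OnePoint.V-resp ℓ (isThinKurepaOn 0 1) 2 {env₂ w F} {env₂ w₀ F}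
    (λ { zero → ≋-sym (normal-≋ w) ; (suc _) → ≋-refl }) kurepa
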